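{- Let $n,m$ be positive integers. For a dominant region $R\in\mathcal{R}^m_n$ with Shi tableau entries $k_{i,j}=k_{i,j}(R)$, $1\le i\le j\le n$, define $\varphi_n(R)=(\lambda_1,\dots,\lambda_n)$ with $\lambda_i=\sum_{j=i}^n k_{i,j}$. Then $\varphi_n$ is a bijection from $\mathcal{R}^m_n$ onto $\mathcal{P}^m_n$.
   Context: Type $A_n$: $V=\{x\in\mathbb{R}^{n+1}:\sum x_i=0\}$, positive roots $\alpha_{ij}=\varepsilon_i-\varepsilon_{j+1}$ ($1\le i\le j\le n$), $H_{\alpha,k}=\{v\in V:\langle v,\alpha\rangle=k\}$. $\mathrm{Cat}^m(A_n)$ is the arrangement of the $H_{\alpha,k}$, $\alpha$ positive, $0\le k\le m$; $\mathcal{R}^m_n$ is the set of its dominant regions (regions contained in $\{v:\langle v,\alpha\rangle\ge0\ \forall\alpha>0\}$). For $R\in\mathcal{R}^m_n$ and $1\le i\le j\le n$, $k_{i,j}(R)$ is the unique integer $k\in\{0,\dots,m\}$ such that for all $x\in R$: $k\le\langle\alpha_{ij},x\rangle\le k+1$ if $k<m$, and $\langle\alpha_{ij},x\rangle\ge m$ if $k=m$ (i.e. the number of hyperplanes $H_{\alpha_{ij},t}$, $1\le t\le m$, separating $R$ from the origin). The collection $\{k_{i,j}(R)\}$ is the Shi tableau of $R$. $\mathcal{P}^m_n$ is the set of integer partitions $(\lambda_1\ge\cdots\ge\lambda_n\ge0)$ with $\lambda_i\le m(n-i+1)$. -}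

module Defs where

open import Algebra.Apartness.Structures using (IsHeytingField)
open import Algebra.Bundles using (CommutativeRing)
import Algebra.Definitions.RawMonoid as RawMonoidDefinitions
import Algebra.Properties.CommutativeMonoid.Sum as RealSum
import Algebra.Properties.Monoid.Mult as RealMult
import Algebra.Properties.Ring as RingProperties
open import Data.Bool.Base using (if_then_else_)
open import Data.Empty using (⊥-elim)
open import Data.Fin.Base using (Fin; zero; suc; toℕ; inject₁)
import Data.Fin.Base as Fin
import Data.Fin.Properties as Fin
open import Data.Nat.Base as ℕ using (ℕ; zero; suc; _∸_; z≤n; s≤s)
import Data.Nat.Properties as ℕ
open import Data.Product.Base using (∃; ∃-syntax; _×_; _,_; proj₁; proj₂)
open import Data.Sum.Base using (_⊎_; inj₁; inj₂)
import Data.Vec.Functional as Vector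
open import Function.Base using (_∘_)
open import Level using (0ℓ)
open import Relation.Binary.Core using (Rel)
open import Relation.Binary.Definitions using (tri<; tri≈; tri>)
open import Relation.Binary.PropositionalEquality as ≡ using (_≡_)
open import Relation.Binary.Structures using (IsStrictPartialOrder)
open import Relation.Nullary using (¬_; Dec; yes; no; does)
open import Relation.Unary using (Pred; _∈_; _⊆_; _∩_; _∪_; _≐_; Empty; Satisfiable)

-- The standard library has no real numbers, so they are axiomatised as a
-- Cauchy-complete Archimedean ordered field.  The axioms determine ℝ up to
-- isomorphism, and they hold constructively of Bishop's reals with their
-- setoid equality.
record RealNumbers : Set₁ where
  infixl 6 _+_
  infixl 7 _*_
  infix  8 -_
  infix  4 _≈_ _<_ _≤_ _#_
  field
    Carrier : Set
    _≈_ _<_ : Rel Carrier 0ℓ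
    _+_ _*_ : Carrier → Carrier → Carrier
    -_      : Carrier → Carrier
    0# 1#   : Carrier

  -- The positive form of inequality, classically the same as ¬ (x ≈ y).
  _#_ : Rel Carrier 0ℓ
  x # y = (x < y) ⊎ (y < x)

  _≤_ : Rel Carrier 0ℓ
  x ≤ y = ¬ (y < x)

  Within : Carrier → Rel Carrier 0ℓ
  Within ε x y = (x < y + ε) × (y < x + ε)

  Cauchy : (ℕ → Carrier) → Set
  Cauchy s = ∀ ε → 0# < ε →
    ∃[ N ] (∀ p q → N ℕ.≤ p → N ℕ.≤ q → Within ε (s p) (s q))

  _ConvergesTo_ : (ℕ → Carrier) → Carrier → Set
  s ConvergesTo l = ∀ ε → 0# < ε → ∃[ N ] (∀ p → N ℕ.≤ p → Within ε (s p) l)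

  field
    isHeytingField       : IsHeytingField _≈_ _#_ _+_ _*_ -_ 0# 1#
    isStrictPartialOrder : IsStrictPartialOrder _≈_ _<_
    +-monoˡ-<            : ∀ z {x y} → x < y → x + z < y + z
    *-pos                : ∀ {x y} → 0# < x → 0# < y → 0# < x * y

  open IsHeytingField isHeytingField public
    using (isCommutativeRing; #-cotrans; #⇒invertible; invertible⇒#; tight)
  open IsStrictPartialOrder isStrictPartialOrder public
    using (<-respʳ-≈; <-respˡ-≈)
    renaming ( irrefl to <-irrefl; trans to <-trans; asym to <-asym)

  commutativeRing : CommutativeRing 0ℓ 0ℓ
  commutativeRing = record { isCommutativeRing = isCommutativeRing }

  open CommutativeRing commutativeRing public
    hiding (Carrier; _≈_; _+_; _*_; -_; 0#; 1#; isCommutativeRing; zero)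

  open RealMult +-monoid public using () renaming (_×_ to _·_)

  -- The image of a natural number in ℝ.
  ι : ℕ → Carrier
  ι k = k · 1#

  field
    archimedean : ∀ x → ∃[ k ] x < ι k
    complete    : ∀ s → Cauchy s → ∃[ l ] s ConvergesTo l

module RealProperties (ℝ : RealNumbers) where
  open RealNumbers ℝ
  open RingProperties ring
  open import Relation.Binary.Reasoning.Setoid setoid

  <-cotrans : ∀ {x y} → x < y → ∀ z → (x < z) ⊎ (z < y)
  <-cotrans x<y z with #-cotrans (inj₁ x<y) z
  ... | inj₁ (inj₁ x<z) = inj₁ x<z
  ... | inj₁ (inj₂ z<x) = inj₂ (<-trans z<x x<y)
  ... | inj₂ (inj₁ z<y) = inj₂ z<y
  ... | inj₂ (inj₂ y<z) = inj₁ (<-trans x<y y<z)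

  <⇒≤ : ∀ {x y} → x < y → x ≤ y
  <⇒≤ x<y y<x = <-asym x<y y<x

  <-≤-trans : ∀ {x y z} → x < y → y ≤ z → x < z
  <-≤-trans x<y y≤z with <-cotrans x<y _
  ... | inj₁ x<z = x<z
  ... | inj₂ z<y = ⊥-elim (y≤z z<y)

  ≤-<-trans : ∀ {x y z} → x ≤ y → y < z → x < z
  ≤-<-trans x≤y y<z with <-cotrans y<z _
  ... | inj₁ y<x = ⊥-elim (x≤y y<x)
  ... | inj₂ x<z = x<z

  +-monoʳ-< : ∀ z {x y} → x < y → z + x < z + y
  +-monoʳ-< z x<y =
    <-respˡ-≈ (+-comm _ z) (<-respʳ-≈ (+-comm _ z) (+-monoˡ-< z x<y))

  cancelʳ : ∀ x y → (x + y) - y ≈ x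
  cancelʳ x y = trans (+-assoc x y (- y)) (trans (+-congˡ (-‿inverseʳ y)) (+-identityʳ x))

  neg-mono-< : ∀ {x y} → x < y → - y < - x
  neg-mono-< {x} {y} x<y =
    <-respˡ-≈ left (<-respʳ-≈ right (+-monoˡ-< (- x - y) x<y))
    where
    right : y + (- x - y) ≈ - x
    right = trans (+-comm y _) (trans (+-assoc (- x) (- y) y)
              (trans (+-congˡ (-‿inverseˡ y)) (+-identityʳ (- x))))
    left : x + (- x - y) ≈ - y
    left = trans (sym (+-assoc x (- x) (- y)))
             (trans (+-congʳ (-‿inverseʳ x)) (+-identityˡ (- y)))

  neg-cancel-< : ∀ {x y} → - x < - y → y < x
  neg-cancel-< p = <-respˡ-≈ (-‿involutive _) (<-respʳ-≈ (-‿involutive _) (neg-mono-< p))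

  0<1 : 0# < 1#
  0<1 with invertible⇒# {1#} {0#} (1# , trans (*-identityˡ _) one-0 , trans (*-identityʳ _) one-0)
    where
    one-0 : 1# - 0# ≈ 1#
    one-0 = trans (+-congˡ -0#≈0#) (+-identityʳ 1#)
  ... | inj₂ 0<1 = 0<1
  ... | inj₁ 1<0 = <-respʳ-≈ square (*-pos 0<-1 0<-1)
    where
    0<-1 : 0# < - 1#
    0<-1 = <-respˡ-≈ -0#≈0# (neg-mono-< 1<0)
    square : - 1# * - 1# ≈ 1#
    square = trans (-1*x≈-x (- 1#)) (-‿involutive 1#)

  x<1+x : ∀ x → x < 1# + x
  x<1+x x = <-respˡ-≈ (+-identityˡ x) (+-monoˡ-< x 0<1)

  ι-mono-≤ : ∀ {k l} → k ℕ.≤ l → ι k ≤ ι l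
  ι-mono-≤ {l = zero}  z≤n     p = <-irrefl refl p
  ι-mono-≤ {l = suc l} z≤n     p = ι-mono-≤ {l = l} z≤n (<-trans (x<1+x (ι l)) p)
  ι-mono-≤ (s≤s k≤l) p = ι-mono-≤ k≤l
    (<-respˡ-≈ (drop _) (<-respʳ-≈ (drop _) (+-monoʳ-< (- 1#) p)))
    where
    drop : ∀ x → - 1# + (1# + x) ≈ x
    drop x = trans (sym (+-assoc _ _ x)) (trans (+-congʳ (-‿inverseˡ 1#)) (+-identityˡ x))

  halve : ∀ d → 0# < d → ∃[ δ ] 0# < δ × δ + δ ≈ d
  halve d 0<d = d * h , *-pos 0<d 0<h , doubled
    where
    2# = 1# + 1#
    0<2 : 0# < 2#
    0<2 = <-trans 0<1 (x<1+x 1#)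
    inv = #⇒invertible {2#} {0#} (inj₂ 0<2)
    h = proj₁ inv
    h+h≈1 : h + h ≈ 1#
    h+h≈1 = begin
      h + h            ≈⟨ +-cong (*-identityʳ h) (*-identityʳ h) ⟨
      h * 1# + h * 1#  ≈⟨ distribˡ h 1# 1# ⟨
      h * 2#           ≈⟨ *-congˡ (trans (+-congˡ -0#≈0#) (+-identityʳ 2#)) ⟨
      h * (2# - 0#)    ≈⟨ proj₁ (proj₂ inv) ⟩
      1#               ∎
    0<h : 0# < h
    0<h with <-cotrans 0<1 h
    ... | inj₁ 0<h = 0<h
    ... | inj₂ h<1 = <-respˡ-≈ (-‿inverseʳ h)
      (<-respʳ-≈ (trans (+-congʳ (sym h+h≈1)) (cancelʳ h h)) (+-monoˡ-< (- h) h<1))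
    doubled : d * h + d * h ≈ d
    doubled = trans (sym (distribˡ d h h)) (trans (*-congˡ h+h≈1) (*-identityʳ d))

module Catalan (ℝ : RealNumbers) (n m : ℕ) where
  open RealNumbers ℝ
  open RealSum +-commutativeMonoid using (sum; sum-replicate-zero; sum-cong-≋)
  open RealProperties ℝ
  open RingProperties ring

  ⟨_,_⟩ : ∀ {d} → Vector.Vector Carrier d → Vector.Vector Carrier d → Carrier
  ⟨ x , y ⟩ = sum λ l → x l * y l

  ε : ∀ {d} → Fin d → Vector.Vector Carrier d
  ε i l = if does (i Fin.≟ l) then 1# else 0#

  record V : Set where
    field
      coord : Vector.Vector Carrier (suc n)
      sum≈0 : sum coord ≈ 0#
  open V public

  -- Indices are 0-based: for i ≤ j in Fin n this is the positive root
  -- α_{i+1,j+1} = ε_{i+1} - ε_{j+2} in 1-based numbering.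
  α : Fin n → Fin n → Vector.Vector Carrier (suc n)
  α i j l = ε (inject₁ i) l - ε (suc j) l

  -- The complement of the union of the hyperplanes
  -- H_{α,k} = { v ∣ ⟨ coord v , α ⟩ ≈ ι k }, 0 ≤ k ≤ m.  Not lying on a hyperplane
  -- is expressed by apartness, so that the side is decided.
  Complement : Pred V 0ℓ
  Complement v = ∀ i j → i Fin.≤ j → ∀ k → k ℕ.≤ m → ⟨ coord v , α i j ⟩ # ι k

  -- The usual topology of V, given by the balls of the sup-norm.
  IsOpen : Pred V 0ℓ → Set
  IsOpen A = ∀ x → x ∈ A → ∃[ δ ] 0# < δ ×
    (∀ y → (∀ l → Within δ (coord x l) (coord y l)) → y ∈ A)

  IsConnected : Pred V 0ℓ → Set₁
  IsConnected C = ∀ A B → IsOpen A → IsOpen B → C ⊆ A ∪ B →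
    Satisfiable (C ∩ A) → Satisfiable (C ∩ B) → ¬ Empty (C ∩ (A ∩ B))

  -- Regions are the connected components of the complement.
  record IsRegion (R : Pred V 0ℓ) : Set₁ where
    field
      inhabited  : Satisfiable R
      complement : R ⊆ Complement
      connected  : IsConnected R
      maximal    : ∀ C → IsConnected C → C ⊆ Complement → R ⊆ C → C ⊆ R

  DominantChamber : Pred V 0ℓ
  DominantChamber v = ∀ i j → i Fin.≤ j → 0# ≤ ⟨ coord v , α i j ⟩

  record DominantRegion : Set₁ where
    field
      points   : Pred V 0ℓ
      isRegion : IsRegion points
      dominant : points ⊆ DominantChamber
    open IsRegion isRegion public
  open DominantRegion public

  _≈ᴿ_ : Rel DominantRegion 0ℓ
  R ≈ᴿ R′ = points R ≐ points R′

  IsShiEntry : DominantRegion → Fin n → Fin n → ℕ → Set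
  IsShiEntry R i j k = k ℕ.≤ m × (∀ x → x ∈ points R →
    (k ℕ.< m → ι k ≤ ⟨ coord x , α i j ⟩ × ⟨ coord x , α i j ⟩ ≤ ι (suc k)) ×
    (k ≡ m → ι m ≤ ⟨ coord x , α i j ⟩))

  open import Relation.Binary.Reasoning.Setoid setoid

  pair-ε : ∀ {d} (x : Vector.Vector Carrier d) i → ⟨ x , ε i ⟩ ≈ x i
  pair-ε {suc d} x zero = trans
    (+-cong (*-identityʳ _)
      (trans (sum-cong-≋ {d} λ l → zeroʳ (x (suc l))) (sum-replicate-zero d)))
    (+-identityʳ _)
  pair-ε {suc d} x (suc i) =
    trans (+-cong (zeroʳ _) (pair-ε (x ∘ suc) i)) (+-identityˡ _)

  pair-diff : ∀ {d} (x y z : Vector.Vector Carrier d) →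
    ⟨ x , (λ l → y l - z l) ⟩ ≈ ⟨ x , y ⟩ - ⟨ x , z ⟩
  pair-diff {zero}  x y z = sym (-‿inverseʳ 0#)
  pair-diff {suc d} x y z = begin
    x₀ * (y₀ - z₀) + _               ≈⟨ +-cong (x[y-z]≈xy-xz x₀ y₀ z₀)
                                          (pair-diff (x ∘ suc) (y ∘ suc) (z ∘ suc)) ⟩
    (a - b) + (s - t)                ≈⟨ +-assoc a (- b) _ ⟩
    a + (- b + (s - t))              ≈⟨ +-congˡ (x+[y-z] (- b) s t) ⟩
    a + (s + (- b - t))              ≈⟨ +-congˡ (+-congˡ (-‿+-comm b t)) ⟩
    a + (s - (b + t))                ≈⟨ +-assoc a s _ ⟨
    (a + s) - (b + t)                ∎
    where
    x₀ = x zero ; y₀ = y zero ; z₀ = z zero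
    a = x₀ * y₀ ; b = x₀ * z₀
    s = ⟨ x ∘ suc , y ∘ suc ⟩
    t = ⟨ x ∘ suc , z ∘ suc ⟩
    x+[y-z] : ∀ p q r → p + (q - r) ≈ q + (p - r)
    x+[y-z] p q r = trans (sym (+-assoc p q _))
      (trans (+-congʳ (+-comm p q)) (+-assoc q p _))

  pairing : ∀ x i j → ⟨ x , α i j ⟩ ≈ x (inject₁ i) - x (suc j)
  pairing x i j = trans (pair-diff x (ε (inject₁ i)) (ε (suc j)))
    (+-cong (pair-ε x _) (-‿cong (pair-ε x _)))

  difference-open : ∀ a b c → IsOpen (λ v → coord v a - coord v b < c)
  difference-open a b c x x<c = δ , 0<δ , near
    where
    xa = coord x a
    xb = coord x b
    d = c - (xa - xb)
    0<d : 0# < d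
    0<d = <-respˡ-≈ (-‿inverseʳ _) (+-monoˡ-< (- (xa - xb)) x<c)
    half = halve d 0<d
    δ = proj₁ half
    0<δ = proj₁ (proj₂ half)
    near : ∀ y → (∀ l → Within δ (coord x l) (coord y l)) → coord y a - coord y b < c
    near y close = <-respʳ-≈ total
      (<-trans (+-monoˡ-< (- yb) (proj₂ (close a))) (+-monoʳ-< (xa + δ) -yb<))
      where
      yb = coord y b
      -yb< : - yb < δ - xb
      -yb< = <-respˡ-≈ (trans (+-comm xb _) (trans (+-assoc (- yb) (- xb) xb)
                 (trans (+-congˡ (-‿inverseˡ xb)) (+-identityʳ (- yb)))))
        (<-respʳ-≈ (trans (+-congʳ (+-comm yb δ)) (trans (+-assoc δ yb _)
                     (+-congˡ (trans (sym (+-assoc yb (- yb) (- xb)))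
                       (trans (+-congʳ (-‿inverseʳ yb)) (+-identityˡ (- xb)))))))
          (+-monoˡ-< (- yb - xb) (proj₁ (close b))))
      total : (xa + δ) + (δ - xb) ≈ c
      total = begin
        (xa + δ) + (δ - xb)    ≈⟨ +-assoc xa δ _ ⟩
        xa + (δ + (δ - xb))    ≈⟨ +-congˡ (+-assoc δ δ _) ⟨
        xa + ((δ + δ) - xb)    ≈⟨ +-congˡ (+-congʳ (proj₂ (proj₂ half))) ⟩
        xa + (d - xb)          ≈⟨ +-congˡ (+-comm d _) ⟩
        xa + (- xb + d)        ≈⟨ +-assoc xa (- xb) d ⟨
        (xa - xb) + d          ≈⟨ +-comm _ d ⟩
        d + (xa - xb)          ≈⟨ +-assoc c _ _ ⟩
        c + _                  ≈⟨ +-congˡ (-‿inverseˡ (xa - xb)) ⟩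
        c + 0#                 ≈⟨ +-identityʳ c ⟩
        c                      ∎

  below above : Fin n → Fin n → Carrier → Pred V 0ℓ
  below i j c v = ⟨ coord v , α i j ⟩ < c
  above i j c v = c < ⟨ coord v , α i j ⟩

  below-open : ∀ i j c → IsOpen (below i j c)
  below-open i j c x x<c
    with difference-open (inject₁ i) (suc j) c x (<-respˡ-≈ (pairing (coord x) i j) x<c)
  ... | δ , 0<δ , near =
    δ , 0<δ , λ y close → <-respˡ-≈ (sym (pairing (coord y) i j)) (near y close)

  neg-pairing : ∀ x i j → - ⟨ x , α i j ⟩ ≈ x (suc j) - x (inject₁ i)
  neg-pairing x i j = trans (-‿cong (pairing x i j)) (⁻¹-anti-homo‿- _ _)

  above-open : ∀ i j c → IsOpen (above i j c)
  above-open i j c x c<x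
    with difference-open (suc j) (inject₁ i) (- c) x
           (<-respˡ-≈ (neg-pairing (coord x) i j) (neg-mono-< c<x))
  ... | δ , 0<δ , near = δ , 0<δ , λ y close →
    neg-cancel-< (<-respˡ-≈ (sym (neg-pairing (coord y) i j)) (near y close))

  -- A region lies on a single side of each hyperplane.
  one-side : ∀ R i j → i Fin.≤ j → ∀ k → k ℕ.≤ m →
    (points R ⊆ λ x → ⟨ coord x , α i j ⟩ < ι k) ⊎
    (points R ⊆ λ x → ι k < ⟨ coord x , α i j ⟩)
  one-side R i j i≤j k k≤m with inhabited R
  ... | x , x∈R with complement R x∈R i j i≤j k k≤m
  ...   | inj₁ x<k = inj₁ λ {y} y∈R → side y y∈R
    where
    side : ∀ y → y ∈ points R → ⟨ coord y , α i j ⟩ < ι k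
    side y y∈R with complement R y∈R i j i≤j k k≤m
    ... | inj₁ y<k = y<k
    ... | inj₂ k<y = ⊥-elim (connected R (below i j (ι k)) (above i j (ι k))
            (below-open i j (ι k)) (above-open i j (ι k))
            (λ z∈R → complement R z∈R i j i≤j k k≤m)
            (x , x∈R , x<k) (y , y∈R , k<y) λ _ (_ , z<k , k<z) → <-asym z<k k<z)
  ...   | inj₂ k<x = inj₂ λ {y} y∈R → side y y∈R
    where
    side : ∀ y → y ∈ points R → ι k < ⟨ coord y , α i j ⟩
    side y y∈R with complement R y∈R i j i≤j k k≤m
    ... | inj₂ k<y = k<y
    ... | inj₁ y<k = ⊥-elim (connected R (below i j (ι k)) (above i j (ι k))
            (below-open i j (ι k)) (above-open i j (ι k))
            (λ z∈R → complement R z∈R i j i≤j k k≤m)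
            (y , y∈R , y<k) (x , x∈R , k<x) λ _ (_ , z<k , k<z) → <-asym z<k k<z)

  shi-exists : ∀ R i j → i Fin.≤ j → ∃ (IsShiEntry R i j)
  shi-exists R i j i≤j = search m 0 (ℕ.+-identityʳ m) λ x x∈R → dominant R x∈R i j i≤j
    where
    search : ∀ fuel k → fuel ℕ.+ k ≡ m →
      (∀ x → x ∈ points R → ι k ≤ ⟨ coord x , α i j ⟩) → ∃ (IsShiEntry R i j)
    search zero k ≡.refl k≤ =
      k , ℕ.≤-refl , λ x x∈R → (λ k<k → ⊥-elim (ℕ.<-irrefl ≡.refl k<k)) , λ _ → k≤ x x∈R
    search (suc fuel) k eq k≤ with one-side R i j i≤j (suc k) k<m
      where k<m = ≡.subst (suc k ℕ.≤_) eq (s≤s (ℕ.m≤n+m k fuel))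
    ... | inj₁ R<k+1 = k , ℕ.<⇒≤ k<m , λ x x∈R →
            (λ _ → k≤ x x∈R , <⇒≤ (R<k+1 x∈R)) ,
            λ k≡m → ⊥-elim (ℕ.<-irrefl k≡m k<m)
      where k<m = ≡.subst (suc k ℕ.≤_) eq (s≤s (ℕ.m≤n+m k fuel))
    ... | inj₂ k+1<R = search fuel (suc k) (≡.trans (ℕ.+-suc fuel k) eq)
            λ x x∈R → <⇒≤ (k+1<R x∈R)

  shi-not-< : ∀ R i j → i Fin.≤ j → ∀ {k l} →
    IsShiEntry R i j k → IsShiEntry R i j l → ¬ (k ℕ.< l)
  shi-not-< R i j i≤j {k} {l} (_ , K) (l≤m , L) k<l =
    contra (complement R x∈R i j i≤j (suc k) k<m)
    where
    x = proj₁ (inhabited R)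
    x∈R = proj₂ (inhabited R)
    k<m = ℕ.<-≤-trans k<l l≤m
    lower : ι l ≤ ⟨ coord x , α i j ⟩
    lower with ℕ.m≤n⇒m<n∨m≡n l≤m
    ... | inj₁ l<m = proj₁ (proj₁ (L x x∈R) l<m)
    ... | inj₂ ≡.refl = proj₂ (L x x∈R) ≡.refl
    contra : ¬ (⟨ coord x , α i j ⟩ # ι (suc k))
    contra (inj₁ x<k+1) = ι-mono-≤ k<l (≤-<-trans lower x<k+1)
    contra (inj₂ k+1<x) = proj₂ (proj₁ (K x x∈R) k<m) k+1<x

  shi-unique : ∀ R i j → i Fin.≤ j → ∀ {k l} →
    IsShiEntry R i j k → IsShiEntry R i j l → k ≡ l
  shi-unique R i j i≤j {k} {l} K L with ℕ.<-cmp k l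
  ... | tri< k<l _ _ = ⊥-elim (shi-not-< R i j i≤j K L k<l)
  ... | tri≈ _ k≡l _ = k≡l
  ... | tri> _ _ l<k = ⊥-elim (shi-not-< R i j i≤j L K l<k)

  -- The unique k with IsShiEntry R i j k.
  shi : DominantRegion → ∀ i j → i Fin.≤ j → ℕ
  shi R i j i≤j = proj₁ (shi-exists R i j i≤j)

  open RawMonoidDefinitions ℕ.+-0-rawMonoid using () renaming (sum to sumℕ)

  shiOrZero : DominantRegion → ∀ i j → Dec (i Fin.≤ j) → ℕ
  shiOrZero R i j (yes i≤j) = shi R i j i≤j
  shiOrZero R i j (no _)    = 0

  -- The sum ranges over j ≥ i only.
  φ : DominantRegion → Fin n → ℕ
  φ R i = sumℕ λ j → shiOrZero R i j (i Fin.≤? j)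

  -- With 0-based i, the bound m (n - i + 1) becomes m * (n ∸ toℕ i).
  record Partition : Set where
    field
      part       : Fin n → ℕ
      decreasing : ∀ {i j} → i Fin.≤ j → part j ℕ.≤ part i
      bounded    : ∀ i → part i ℕ.≤ m ℕ.* (n ∸ toℕ i)
  open Partition public

  _≈ᴾ_ : Rel Partition 0ℓ
  p ≈ᴾ q = ∀ i → part p i ≡ part q i

{-# OPTIONS --safe #-}
module Submission where

-- A dominant region is the cell of points v = (x₀ > … > xₙ) whose differences lie in
-- the intervals prescribed by its Shi tableau: such a cell is convex, hence connected
-- (bisection), so it is a component of the complement.  It remains to invert the row
-- sums of tableaux, by induction on n, removing the first point.  Given x₁ > … > xₙ, a
-- point x₀ moving from x₁ to infinity crosses the thresholds xⱼ + t, 1 ≤ t ≤ m, one at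
-- a time, as these are pairwise distinct; each crossing raises the first row sum by 1,
-- from the second row sum up to m n.  Conversely, two first rows with equal sums over
-- the same remaining tableau agree: otherwise two pairs of entries cross, which forces
-- a hyperplane between x and y for some root not involving the first point.

open import Defs
import Algebra.Properties.CommutativeMonoid.Sum as RealSum
import Algebra.Properties.Monoid.Mult as Mult
import Algebra.Properties.Ring as RingProperties
import Algebra.Properties.Semiring.Mult.TCOptimised as SemiringMult
import Algebra.Solver.Ring as RingSolver
open import Algebra.Definitions using (Invertible)
open import Algebra.Solver.Ring.AlmostCommutativeRing
  using (_-Raw-AlmostCommutative⟶_; fromCommutativeRing)
open import Data.Empty using (⊥; ⊥-elim)
open import Data.Fin.Base as Fin using (Fin; zero; suc; toℕ; inject₁)
import Data.Fin.Properties as Fin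
open import Data.Integer.Base as ℤ using (ℤ; +_; -[1+_]; _⊖_; _◃_)
import Data.Integer.Properties as ℤ
open import Data.List.Base using (List; []; _∷_; _++_; length)
open import Data.List.Properties using (length-++)
open import Data.List.Relation.Unary.All using (All; []; _∷_)
import Data.List.Relation.Unary.All.Properties as All
open import Data.List.Relation.Unary.AllPairs using (AllPairs; []; _∷_)
import Data.List.Relation.Unary.AllPairs.Properties as AllPairs
open import Data.Maybe.Base using (Maybe; just; nothing)
open import Data.Nat.Base as ℕ using (ℕ; zero; suc; z≤n; s≤s; _∸_; NonZero)
import Data.Nat.Properties as ℕ
open import Algebra.Properties.Monoid.Sum ℕ.+-0-monoid
  using (sum-cong-≗) renaming (sum to sumℕ)
open import Data.Product.Base using (Σ-syntax; ∃-syntax; _×_; _,_; proj₁; proj₂; swap)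
import Data.Sign.Base as Sign
open import Data.Sum.Base as Sum using (_⊎_; inj₁; inj₂)
import Data.Vec.Functional as Vector
open import Function.Base using (_∘_; id)
open import Function.Structures using (IsBijection)
open import Level using (0ℓ)
open import Relation.Binary.Definitions using (tri<; tri≈; tri>)
open import Relation.Binary.PropositionalEquality as ≡ using (_≡_)
open import Relation.Nullary using (Dec; yes; no)
open import Relation.Unary using (Pred; _∈_; _⊆_)

-- Ordered field arithmetic and a ring solver with integer coefficients.

module Reals (ℝ : RealNumbers) where
  open RealNumbers ℝ
  open RealProperties ℝ
  open RingProperties ring
  open SemiringMult semiring using (×-homo-+; ×1-homo-*; 1+×) renaming (_×_ to _×′_)
  open import Relation.Binary.Reasoning.Setoid setoid

  -- With the optimised multiple `_×′_`, `fromℤ (+ 1)` reduces to `1#`, so `con (+ 1)` in a solver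
  -- equation matches `1#` definitionally.
  fromℤ : ℤ → Carrier
  fromℤ (+ k)    = k ×′ 1#
  fromℤ -[1+ k ] = - (suc k ×′ 1#)

  fromℤ-⊖ : ∀ k l → fromℤ (k ⊖ l) ≈ k ×′ 1# - l ×′ 1#
  fromℤ-⊖ k       zero    = sym (trans (+-congˡ -0#≈0#) (+-identityʳ _))
  fromℤ-⊖ zero    (suc l) = sym (+-identityˡ _)
  fromℤ-⊖ (suc k) (suc l) = begin
    fromℤ (suc k ⊖ suc l)            ≡⟨ ≡.cong fromℤ (ℤ.[1+m]⊖[1+n]≡m⊖n k l) ⟩
    fromℤ (k ⊖ l)                    ≈⟨ fromℤ-⊖ k l ⟩
    a - b                            ≈⟨ +-congʳ (cancelʳ a 1#) ⟨
    ((a + 1#) - 1#) - b              ≈⟨ +-assoc _ _ _ ⟩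
    (a + 1#) + (- 1# - b)            ≈⟨ +-cong (+-comm a 1#) (-‿+-comm 1# b) ⟩
    (1# + a) - (1# + b)              ≈⟨ +-cong (1+× k 1#) (-‿cong (1+× l 1#)) ⟨
    suc k ×′ 1# - suc l ×′ 1#        ∎
    where
    a = k ×′ 1#
    b = l ×′ 1#

  fromℤ-+ : ∀ i j → fromℤ (i ℤ.+ j) ≈ fromℤ i + fromℤ j
  fromℤ-+ (+ k)    (+ l)    = ×-homo-+ 1# k l
  fromℤ-+ (+ k)    -[1+ l ] = fromℤ-⊖ k (suc l)
  fromℤ-+ -[1+ k ] (+ l)    = trans (fromℤ-⊖ l (suc k)) (+-comm _ _)
  fromℤ-+ -[1+ k ] -[1+ l ] = begin
    - (suc (suc (k ℕ.+ l)) ×′ 1#)        ≡⟨ ≡.cong (λ s → - (suc s ×′ 1#)) (ℕ.+-suc k l) ⟨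
    - ((suc k ℕ.+ suc l) ×′ 1#)          ≈⟨ -‿cong (×-homo-+ 1# (suc k) (suc l)) ⟩
    - (suc k ×′ 1# + suc l ×′ 1#)        ≈⟨ -‿+-comm _ _ ⟨
    - (suc k ×′ 1#) - suc l ×′ 1#        ∎

  fromℤ-neg : ∀ i → fromℤ (ℤ.- i) ≈ - fromℤ i
  fromℤ-neg (+ zero)  = sym -0#≈0#
  fromℤ-neg (+ suc k) = refl
  fromℤ-neg -[1+ k ]  = sym (-‿involutive _)

  fromℤ-* : ∀ i j → fromℤ (i ℤ.* j) ≈ fromℤ i * fromℤ j
  fromℤ-* (+ k)    (+ l)    = begin
    fromℤ (Sign.+ ◃ k ℕ.* l)  ≡⟨ ≡.cong fromℤ (ℤ.+◃n≡+n (k ℕ.* l)) ⟩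
    (k ℕ.* l) ×′ 1#           ≈⟨ ×1-homo-* k l ⟩
    k ×′ 1# * l ×′ 1#         ∎
  fromℤ-* (+ k)    -[1+ l ] = begin
    fromℤ (Sign.- ◃ k ℕ.* suc l)  ≡⟨ ≡.cong fromℤ (ℤ.-◃n≡-n (k ℕ.* suc l)) ⟩
    fromℤ (ℤ.- + (k ℕ.* suc l))   ≈⟨ fromℤ-neg (+ (k ℕ.* suc l)) ⟩
    - ((k ℕ.* suc l) ×′ 1#)       ≈⟨ -‿cong (×1-homo-* k (suc l)) ⟩
    - (k ×′ 1# * suc l ×′ 1#)     ≈⟨ -‿distribʳ-* _ _ ⟩
    k ×′ 1# * - (suc l ×′ 1#)     ∎
  fromℤ-* -[1+ k ] (+ l)    = begin
    fromℤ (Sign.- ◃ suc k ℕ.* l)  ≡⟨ ≡.cong fromℤ (ℤ.-◃n≡-n (suc k ℕ.* l)) ⟩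
    fromℤ (ℤ.- + (suc k ℕ.* l))   ≈⟨ fromℤ-neg (+ (suc k ℕ.* l)) ⟩
    - ((suc k ℕ.* l) ×′ 1#)       ≈⟨ -‿cong (×1-homo-* (suc k) l) ⟩
    - (suc k ×′ 1# * l ×′ 1#)     ≈⟨ -‿distribˡ-* _ _ ⟩
    - (suc k ×′ 1#) * l ×′ 1#     ∎
  fromℤ-* -[1+ k ] -[1+ l ] = begin
    (suc k ℕ.* suc l) ×′ 1#            ≈⟨ ×1-homo-* (suc k) (suc l) ⟩
    a * b                              ≈⟨ -‿involutive _ ⟨
    - - (a * b)                        ≈⟨ -‿cong (-‿distribˡ-* a b) ⟩
    - (- a * b)                        ≈⟨ -‿distribʳ-* (- a) b ⟩
    - a * - b                          ∎
    where
    a = suc k ×′ 1#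
    b = suc l ×′ 1#

  fromℤ-homomorphism :
    ℤ.+-*-rawRing -Raw-AlmostCommutative⟶ fromCommutativeRing commutativeRing
  fromℤ-homomorphism = record
    { ⟦_⟧    = fromℤ
    ; +-homo = fromℤ-+
    ; *-homo = fromℤ-*
    ; -‿homo = fromℤ-neg
    ; 0-homo = refl
    ; 1-homo = refl
    }

  fromℤ-≈? : ∀ i j → Maybe (fromℤ i ≈ fromℤ j)
  fromℤ-≈? i j with i ℤ.≟ j
  ... | yes i≡j = just (reflexive (≡.cong fromℤ i≡j))
  ... | no  _   = nothing

  open RingSolver ℤ.+-*-rawRing (fromCommutativeRing commutativeRing)
    fromℤ-homomorphism fromℤ-≈? public
    using (solve; _:=_; _:+_; _:-_; _:*_; :-_; con)

  ι-+ : ∀ k l → ι (k ℕ.+ l) ≈ ι k + ι l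
  ι-+ k l = Mult.×-homo-+ +-monoid 1# k l

  -- Here and below, opaque definitions keep `with` abstractions from normalising the
  -- proofs produced by the ring solver.
  opaque
    <-via : ∀ {x y u v} → x < y → y - x ≈ v - u → u < v
    <-via {x} {y} {u} {v} x<y y-x≈v-u = <-respˡ-≈ (+-identityˡ u) (<-respʳ-≈ v-u+u≈v
      (+-monoˡ-< u (<-respˡ-≈ (-‿inverseʳ x) (<-respʳ-≈ y-x≈v-u (+-monoˡ-< (- x) x<y)))))
      where
      v-u+u≈v : (v - u) + u ≈ v
      v-u+u≈v = solve 2 (λ v u → v :- u :+ u := v) refl v u

  -- Together with `<-via`, this trades an inequality for one whose sides have the same difference,
  -- which leaves a ring identity for the solver.
  ≤-via : ∀ {x y u v} → x ≤ y → y - x ≈ v - u → u ≤ v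
  ≤-via {x} {y} {u} {v} x≤y eq v<u = x≤y (<-via v<u (begin
    u - v      ≈⟨ solve 2 (λ u v → u :- v := :- (v :- u)) refl u v ⟩
    - (v - u)  ≈⟨ -‿cong eq ⟨
    - (y - x)  ≈⟨ solve 2 (λ x y → :- (y :- x) := x :- y) refl x y ⟩
    x - y      ∎))

  +-mono-< : ∀ {x y u v} → x < y → u < v → x + u < y + v
  +-mono-< x<y u<v = <-trans (+-monoˡ-< _ x<y) (+-monoʳ-< _ u<v)

  opaque
    +-mono-≤-< : ∀ {x y u v} → x ≤ y → u < v → x + u < y + v
    +-mono-≤-< {x} {y} {u} {v} x≤y u<v = ≤-<-trans
      (≤-via x≤y (solve 3 (λ x y u → y :- x := y :+ u :- (x :+ u)) refl x y u))
      (+-monoʳ-< y u<v)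

  ≤-refl : ∀ {x} → x ≤ x
  ≤-refl = <-irrefl refl

  ≤-trans : ∀ {x y z} → x ≤ y → y ≤ z → x ≤ z
  ≤-trans x≤y y≤z z<x = y≤z (<-≤-trans z<x x≤y)

  ι-mono-< : ∀ {k l} → k ℕ.< l → ι k < ι l
  ι-mono-< {k} k<l = <-≤-trans (x<1+x (ι k)) (ι-mono-≤ k<l)

  ι-cancel-< : ∀ {k l} → ι k < ι l → k ℕ.< l
  ι-cancel-< ιk<ιl = ℕ.≰⇒> λ l≤k → ι-mono-≤ l≤k ιk<ιl

  opaque
    0<⇒inverse : ∀ {x} → 0# < x → ∃[ y ] 0# < y × x * y ≈ 1#
    0<⇒inverse {x} 0<x = y , 0<y , xy≈1
      where
      inverse : Invertible _≈_ 1# _*_ (x - 0#)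
      inverse = #⇒invertible (inj₂ 0<x)
      y : Carrier
      y = proj₁ inverse
      xy≈1 : x * y ≈ 1#
      xy≈1 = trans (solve 2 (λ x y → x :* y := (x :- con (+ 0)) :* y) refl x y)
        (proj₂ (proj₂ inverse))
      0<y : 0# < y
      0<y with invertible⇒# {y} {0#} (x ,
                 trans (solve 2 (λ x y → x :* (y :- con (+ 0)) := x :* y) refl x y) xy≈1 ,
                 trans (solve 2 (λ x y → (y :- con (+ 0)) :* x := x :* y) refl x y) xy≈1)
      ... | inj₂ 0<y = 0<y
      -- A negative inverse would make `x * (- y)`, that is `- 1#`, positive.
      ... | inj₁ y<0 = ⊥-elim (<-asym 0<1 (<-via (*-pos 0<x 0<-y) (begin
        x * (- y) - 0#  ≈⟨ solve 2 (λ x y → x :* (:- y) :- con (+ 0) := con (+ 0) :- x :* y) refl x y ⟩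
        0# - x * y      ≈⟨ +-congˡ (-‿cong xy≈1) ⟩
        0# - 1#         ∎)))
        where
        0<-y : 0# < - y
        0<-y = <-via y<0 (solve 1 (λ y → con (+ 0) :- y := :- y :- con (+ 0)) refl y)

  opaque
    *-cancelʳ-pos : ∀ {x y} → 0# < y → 0# < x * y → 0# < x
    *-cancelʳ-pos {x} {y} 0<y 0<xy with 0<⇒inverse 0<y
    ... | z , 0<z , yz≈1 = <-respʳ-≈ (begin
        x * y * z    ≈⟨ *-assoc x y z ⟩
        x * (y * z)  ≈⟨ *-congˡ yz≈1 ⟩
        x * 1#       ≈⟨ *-identityʳ x ⟩
        x            ∎) (*-pos 0<xy 0<z)

  opaque
    *-nonneg : ∀ {x y} → 0# ≤ x → 0# < y → 0# ≤ x * y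
    *-nonneg {x} {y} 0≤x 0<y xy<0 = 0≤x (<-via 0<-x
        (solve 1 (λ x → :- x :- con (+ 0) := con (+ 0) :- x) refl x))
      where
      0<-x : 0# < - x
      0<-x = *-cancelʳ-pos 0<y (<-via xy<0
        (solve 2 (λ x y → con (+ 0) :- x :* y := :- x :* y :- con (+ 0)) refl x y))

  opaque
    -- The value is `(1 - t) x + t y`. Cotransitivity gives `0 < t` or `t < 1`, so one summand is
    -- positive and the other nonnegative.
    convex-pos : ∀ {x y t} → 0# < x → 0# < y → 0# ≤ t → t ≤ 1# → 0# < x + t * (y - x)
    convex-pos {x} {y} {t} 0<x 0<y 0≤t t≤1 with <-cotrans 0<1 t
    ... | inj₁ 0<t = <-via (+-mono-≤-< (*-nonneg 0≤1-t 0<x) (*-pos 0<t 0<y))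
      (solve 3 (λ x y t → (con (+ 1) :- t) :* x :+ t :* y :- (con (+ 0) :+ con (+ 0))
                       := x :+ t :* (y :- x) :- con (+ 0)) refl x y t)
      where
      0≤1-t : 0# ≤ 1# - t
      0≤1-t = ≤-via t≤1 (solve 1 (λ t → con (+ 1) :- t := con (+ 1) :- t :- con (+ 0)) refl t)
    ... | inj₂ t<1 = <-via (+-mono-≤-< (*-nonneg 0≤t 0<y) (*-pos 0<1-t 0<x))
      (solve 3 (λ x y t → t :* y :+ (con (+ 1) :- t) :* x :- (con (+ 0) :+ con (+ 0))
                       := x :+ t :* (y :- x) :- con (+ 0)) refl x y t)
      where
      0<1-t : 0# < 1# - t
      0<1-t = <-via t<1 (solve 1 (λ t → con (+ 1) :- t := con (+ 1) :- t :- con (+ 0)) refl t)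

  opaque
    half-< : ∀ {x} → 0# < x → ∃[ y ] 0# < y × y < x
    half-< {x} 0<x with halve x 0<x
    ... | y , 0<y , y+y≈x = y , 0<y , <-respʳ-≈ y+y≈x (<-via 0<y
      (solve 1 (λ y → y :- con (+ 0) := y :+ y :- y) refl y))

  opaque
    -- The order is not decidable, so `y` is compared not with `x` but with a gap `u < x`, as
    -- cotransitivity allows.
    below-both : ∀ {x y} → 0# < x → 0# < y → ∃[ z ] 0# < z × z < x × z < y
    below-both {x} {y} 0<x 0<y with half-< 0<x
    ... | u , 0<u , u<x with <-cotrans u<x y
    ...   | inj₁ u<y = u , 0<u , u<x , u<y
    ...   | inj₂ y<x with half-< 0<y
    ...     | v , 0<v , v<y = v , 0<v , <-trans v<y y<x , v<y

-- Finite sums of natural numbers.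

sum-mono-≤ : ∀ {N} {f g : Fin N → ℕ} → (∀ i → f i ℕ.≤ g i) → sumℕ f ℕ.≤ sumℕ g
sum-mono-≤ {zero}  f≤g = z≤n
sum-mono-≤ {suc N} f≤g = ℕ.+-mono-≤ (f≤g zero) (sum-mono-≤ (f≤g ∘ suc))

sum-mono-< : ∀ {N} {f g : Fin N → ℕ} → (∀ i → f i ℕ.≤ g i) →
  ∀ i → f i ℕ.< g i → sumℕ f ℕ.< sumℕ g
sum-mono-< f≤g zero    fi<gi = ℕ.+-mono-<-≤ fi<gi (sum-mono-≤ (f≤g ∘ suc))
sum-mono-< f≤g (suc i) fi<gi = ℕ.+-mono-≤-< (f≤g zero) (sum-mono-< (f≤g ∘ suc) i fi<gi)

sum-≤-* : ∀ m {N} {f : Fin N → ℕ} → (∀ i → f i ℕ.≤ m) → sumℕ f ℕ.≤ m ℕ.* N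
sum-≤-* m {zero}  f≤m = z≤n
sum-≤-* m {suc N} f≤m = ℕ.≤-trans (ℕ.+-mono-≤ (f≤m zero) (sum-≤-* m (f≤m ∘ suc)))
  (ℕ.≤-reflexive (≡.sym (ℕ.*-suc m N)))

-- If `f i < g i` at one index, the absence of crossings gives `f ≤ g` everywhere, so the sums would
-- differ strictly.
sum≡∧uncrossed⇒≡ : ∀ {N} {f g : Fin N → ℕ} → sumℕ f ≡ sumℕ g →
  (∀ i j → f i ℕ.< g i → g j ℕ.< f j → ⊥) → ∀ i → f i ≡ g i
sum≡∧uncrossed⇒≡ {f = f} {g} Σf≡Σg uncrossed i with ℕ.<-cmp (f i) (g i)
... | tri< fi<gi _ _ = ⊥-elim (ℕ.<-irrefl Σf≡Σg
  (sum-mono-< (λ j → ℕ.≮⇒≥ (uncrossed i j fi<gi)) i fi<gi))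
... | tri≈ _ fi≡gi _ = fi≡gi
... | tri> _ _ gi<fi = ⊥-elim (ℕ.<-irrefl (≡.sym Σf≡Σg)
  (sum-mono-< (λ j → ℕ.≮⇒≥ λ fj<gj → uncrossed j i fj<gj gi<fi) i gi<fi))

-- Counting the elements of a list below a point.

module Counting (ℝ : RealNumbers) where
  open RealNumbers ℝ
  open RealProperties ℝ
  open Reals ℝ

  -- Count x ps k also records that x is apart from every element of ps.
  data Count (x : Carrier) : List Carrier → ℕ → Set where
    []    : Count x [] 0
    below : ∀ {p ps k} → p < x → Count x ps k → Count x (p ∷ ps) (suc k)
    above : ∀ {p ps k} → x < p → Count x ps k → Count x (p ∷ ps) k

  count : ∀ {x ps} → All (x #_) ps → ∃[ k ] Count x ps k
  count []               = 0 , []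
  count (inj₁ x<p ∷ aps) = let k , c = count aps in k , above x<p c
  count (inj₂ p<x ∷ aps) = let k , c = count aps in suc k , below p<x c

  count-++ : ∀ {x} ps {qs k} → Count x (ps ++ qs) k →
    ∃[ a ] ∃[ b ] k ≡ a ℕ.+ b × Count x ps a × Count x qs b
  count-++ []       c = 0 , _ , ≡.refl , [] , c
  count-++ (p ∷ ps) (below p<x c) =
    let a , b , eq , ca , cb = count-++ ps c in suc a , b , ≡.cong suc eq , below p<x ca , cb
  count-++ (p ∷ ps) (above x<p c) =
    let a , b , eq , ca , cb = count-++ ps c in a , b , eq , above x<p ca , cb

  count-≤-length : ∀ {x ps k} → Count x ps k → k ℕ.≤ length ps
  count-≤-length []          = z≤n
  count-≤-length (below _ c) = s≤s (count-≤-length c)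
  count-≤-length (above _ c) = ℕ.m≤n⇒m≤1+n (count-≤-length c)

  count-mono : ∀ {x y ps k l} → x ≤ y → Count x ps k → Count y ps l → k ℕ.≤ l
  count-mono x≤y []            []            = z≤n
  count-mono x≤y (below _ c)   (below _ d)   = s≤s (count-mono x≤y c d)
  count-mono x≤y (below p<x c) (above y<p d) = ⊥-elim (x≤y (<-trans y<p p<x))
  count-mono x≤y (above _ c)   (below _ d)   = ℕ.m≤n⇒m≤1+n (count-mono x≤y c d)
  count-mono x≤y (above _ c)   (above _ d)   = count-mono x≤y c d

  -- Unequal counts have a witness: the recursion finds an element `p` of the list with `x < p < y`.
  count-cancel-< : ∀ {x y ps k l} → Count x ps k → Count y ps l → k ℕ.< l → x < y
  count-cancel-< (below _ c)   (below _ d)   k<l = count-cancel-< c d (ℕ.s<s⁻¹ k<l)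
  count-cancel-< (below _ c)   (above _ d)   k<l = count-cancel-< c d (ℕ.<-trans (ℕ.n<1+n _) k<l)
  count-cancel-< (above x<p _) (below p<y _) k<l = <-trans x<p p<y
  count-cancel-< (above _ c)   (above _ d)   k<l = count-cancel-< c d k<l

  opaque
    -- Each element of the list has a positive distance from `x`, and the radius is kept below all
    -- these distances.
    count-locally-constant : ∀ {x ps k} → Count x ps k →
      ∃[ δ ] 0# < δ × (∀ y → Within δ y x → Count y ps k)
    count-locally-constant [] = 1# , 0<1 , λ _ _ → []
    count-locally-constant {x} (below {p} p<x c) with count-locally-constant c
    ... | δ , 0<δ , near with below-both 0<δ (<-via {v = x - p} p<x
        (solve 2 (λ x p → x :- p := x :- p :- con (+ 0)) refl x p))
    ...   | η , 0<η , η<δ , η<x-p = η , 0<η , λ y (y<x+η , x<y+η) → below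
      (<-via (+-mono-< η<x-p x<y+η)
        (solve 4 (λ x p y η → (x :- p) :+ (y :+ η) :- (η :+ x) := y :- p) refl x p y η))
      (near y (<-trans y<x+η (+-monoʳ-< x η<δ) , <-trans x<y+η (+-monoʳ-< y η<δ)))
    count-locally-constant {x} (above {p} x<p c) with count-locally-constant c
    ... | δ , 0<δ , near with below-both 0<δ (<-via {v = p - x} x<p
        (solve 2 (λ x p → p :- x := p :- x :- con (+ 0)) refl x p))
    ...   | η , 0<η , η<δ , η<p-x = η , 0<η , λ y (y<x+η , x<y+η) → above
      (<-via (+-mono-< η<p-x y<x+η)
        (solve 4 (λ x p y η → (p :- x) :+ (x :+ η) :- (η :+ y) := p :- y) refl x p y η))
      (near y (<-trans y<x+η (+-monoʳ-< x η<δ) , <-trans x<y+η (+-monoʳ-< y η<δ)))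

  -- Applied to the head `p` of a list and the remaining elements, this and `count-above` give
  -- points on either side of `p` with the count that `p` has among the rest.
  count-below : ∀ {x ps k} → Count x ps k → ∃[ y ] y < x × Count y ps k
  count-below {x} c with count-locally-constant c
  ... | δ , 0<δ , near with half-< 0<δ
  ...   | η , 0<η , η<δ = x - η , x-η<x , near (x - η)
      ( <-trans x-η<x (<-via 0<δ (solve 2 (λ x δ → δ :- con (+ 0) := x :+ δ :- x) refl x δ))
      , <-via η<δ (solve 3 (λ x δ η → δ :- η := x :- η :+ δ :- x) refl x δ η))
    where
    x-η<x : x - η < x
    x-η<x = <-via 0<η (solve 2 (λ x η → η :- con (+ 0) := x :- (x :- η)) refl x η)

  count-above : ∀ {x ps k} → Count x ps k → ∃[ y ] x < y × Count y ps k
  count-above {x} c with count-locally-constant c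
  ... | δ , 0<δ , near with half-< 0<δ
  ...   | η , 0<η , η<δ = x + η , x<x+η , near (x + η)
      ( +-monoʳ-< x η<δ
      , <-trans x<x+η (<-via 0<δ
          (solve 3 (λ x δ η → δ :- con (+ 0) := x :+ η :+ δ :- (x :+ η)) refl x δ η)))
    where
    x<x+η : x < x + η
    x<x+η = <-via 0<η (solve 2 (λ x η → η :- con (+ 0) := x :+ η :- x) refl x η)

  -- Induction on the list. Let the head `p` have count `k` in the rest. For `s < k` the point of
  -- count `s` in the rest lies below `p`; for `s > k + 1` the point of count `s - 1` in the rest
  -- lies above `p`. The values `k` and `k + 1` are attained just below and just above `p`.
  every-count-attained : ∀ {ps} → AllPairs _#_ ps → ∀ s → s ℕ.≤ length ps → ∃[ x ] Count x ps s
  every-count-attained []               zero    _ = 0# , []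
  every-count-attained {p ∷ ps} (p#ps ∷ apart) s s≤ with count p#ps
  ... | k , c with ℕ.<-cmp s k
  ...   | tri< s<k _ _ =
    let x , d = every-count-attained apart s (ℕ.≤-trans (ℕ.<⇒≤ s<k) (count-≤-length c))
    in x , above (count-cancel-< d c s<k) d
  ...   | tri≈ _ ≡.refl _ = let x , x<p , d = count-below c in x , above x<p d
  every-count-attained {p ∷ ps} (p#ps ∷ apart) (suc s) s≤
      | k , c | tri> _ _ k<1+s with ℕ.m≤n⇒m<n∨m≡n (ℕ.s≤s⁻¹ k<1+s)
  ...     | inj₁ k<s =
    let x , d = every-count-attained apart s (ℕ.s≤s⁻¹ s≤)
    in x , below (count-cancel-< c d k<s) d
  ...     | inj₂ ≡.refl = let x , p<x , d = count-above c in x , below p<x d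

-- Connectedness of the unit interval by bisection, and continuity of scaling.

module IntervalConnectedness (ℝ : RealNumbers) where
  open RealNumbers ℝ
  open RealProperties ℝ
  open Reals ℝ
  open import Relation.Binary.Reasoning.Setoid setoid

  one-half : ∃[ h ] 0# < h × h + h ≈ 1#
  one-half = halve 1# 0<1

  h : Carrier
  h = proj₁ one-half

  0<h : 0# < h
  0<h = proj₁ (proj₂ one-half)

  h+h≈1 : h + h ≈ 1#
  h+h≈1 = proj₂ (proj₂ one-half)

  width : ℕ → Carrier
  width zero    = 1#
  width (suc k) = width k * h

  width-pos : ∀ k → 0# < width k
  width-pos zero    = 0<1
  width-pos (suc k) = *-pos (width-pos k) 0<h

  width-halves : ∀ k → width (suc k) + width (suc k) ≈ width k
  width-halves k = trans (solve 2 (λ w h → w :* h :+ w :* h := w :* (h :+ h)) refl (width k) h)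
    (trans (*-congˡ h+h≈1) (*-identityʳ (width k)))

  opaque
    width-decreasing : ∀ k → width (suc k) < width k
    width-decreasing k = <-respʳ-≈ (width-halves k) (<-via (width-pos (suc k))
      (solve 1 (λ w → w :- con (+ 0) := w :+ w :- w) refl (width (suc k))))

  width-antitone : ∀ {k l} → k ℕ.≤′ l → width l ≤ width k
  width-antitone ℕ.≤′-refl       = ≤-refl
  width-antitone (ℕ.≤′-step {n = l} k≤l) = ≤-trans (<⇒≤ (width-decreasing l)) (width-antitone k≤l)

  -- For `w = width k`, the product `(1 + k) (w / 2)` is half of `w + k w`, where `w ≤ 1` and
  -- `k w < 1`. With the Archimedean axiom this crude bound makes the widths tend to 0.
  ι*width<1 : ∀ k → ι k * width k < 1#
  ι*width<1 zero    = <-via 0<1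
    (solve 0 (con (+ 1) :- con (+ 0) := con (+ 1) :- con (+ 0) :* con (+ 1)) refl)
  ι*width<1 (suc k) = <-via (*-pos 0<h 0<2-) (trans
    (solve 3 (λ i w h → h :* (con (+ 1) :+ con (+ 1) :- (w :+ i :* w)) :- con (+ 0)
                     := h :+ h :- (con (+ 1) :+ i) :* (w :* h))
      refl (ι k) (width k) h) (+-congʳ h+h≈1))
    where
    0<2- : 0# < (1# + 1#) - (width k + ι k * width k)
    0<2- = <-via (+-mono-≤-< (width-antitone (ℕ.z≤′n {k})) (ι*width<1 k))
      (solve 2 (λ a b → a :- b := a :- b :- con (+ 0)) refl _ _)

  -- With `1 / ε < N`, the case `ε < width N` would give `1 < N ε ≤ N * width N < 1`. Cotransitivity
  -- compares `ε` with the gap between `width (suc N)` and `width N`, whence the index `suc N`.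
  width-small : ∀ ε → 0# < ε → ∃[ N ] (∀ k → N ℕ.≤ k → width k < ε)
  width-small ε 0<ε with 0<⇒inverse 0<ε
  ... | e , _ , εe≈1 with archimedean e
  ... | N , e<N with <-cotrans (width-decreasing N) ε
  ...   | inj₁ w<ε = suc N , λ k N≤k → ≤-<-trans (width-antitone (ℕ.≤⇒≤′ N≤k)) w<ε
  ...   | inj₂ ε<w = ⊥-elim (*-nonneg (ι-mono-≤ {0} {N} z≤n)
    (<-via {u = 0#} {v = width N - ε} ε<w
      (solve 2 (λ w e → w :- e := w :- e :- con (+ 0)) refl (width N) ε))
    (<-via (+-mono-< (ι*width<1 N) 1<Nε)
      (solve 4 (λ i w o e → o :+ i :* e :- (i :* w :+ o) := con (+ 0) :- i :* (w :- e)) refl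
        (ι N) (width N) 1# ε)))
    where
    1<Nε : 1# < ι N * ε
    1<Nε = <-via (*-pos 0<ε (<-via {u = 0#} {v = ι N - e} e<N
        (solve 2 (λ n e → n :- e := n :- e :- con (+ 0)) refl (ι N) e)))
      (trans (solve 3 (λ i x e → x :* (i :- e) :- con (+ 0) := i :* x :- x :* e) refl (ι N) ε e)
        (+-congˡ (-‿cong εe≈1)))

  Open : (Carrier → Set) → Set
  Open P = ∀ t → P t → ∃[ η ] 0# < η × (∀ s → Within η s t → P s)

  module _ {P Q : Carrier → Set} (P-open : Open P) (Q-open : Open Q)
           (cover : ∀ t → 0# ≤ t → t ≤ 1# → P t ⊎ Q t) (P0 : P 0#) (Q1 : Q 1#) where

    -- The ends stay in different sets, so that a limit lying in either set is approached by points
    -- of the other.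
    record Bracket (k : ℕ) : Set where
      field
        lo hi    : Carrier
        0≤lo     : 0# ≤ lo
        hi≤1     : hi ≤ 1#
        lo+w≈hi  : lo + width k ≈ hi
        P-lo     : P lo
        Q-hi     : Q hi

      lo<hi : lo < hi
      lo<hi = <-respʳ-≈ lo+w≈hi (<-via (width-pos k)
        (solve 2 (λ l w → w :- con (+ 0) := l :+ w :- l) refl lo (width k)))

      mid : Carrier
      mid = lo + width (suc k)

      mid+w≈hi : mid + width (suc k) ≈ hi
      mid+w≈hi = trans (+-assoc lo _ _) (trans (+-congˡ (width-halves k)) lo+w≈hi)

      lo≤mid : lo ≤ mid
      lo≤mid = <⇒≤ (<-via (width-pos (suc k))
        (solve 2 (λ l w → w :- con (+ 0) := l :+ w :- l) refl lo (width (suc k))))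

      mid≤hi : mid ≤ hi
      mid≤hi = <⇒≤ (<-respʳ-≈ mid+w≈hi (<-via (width-pos (suc k))
        (solve 2 (λ l w → w :- con (+ 0) := l :+ w :- l) refl mid (width (suc k)))))

    open Bracket

    -- The disjunction is an argument rather than a `with`, so that `choose-lo` and `choose-hi` can
    -- split on it.
    choose : ∀ {k} (b : Bracket k) → P (mid b) ⊎ Q (mid b) → Bracket (suc k)
    choose b (inj₁ P-mid) = record
      { lo = mid b ; hi = hi b ; 0≤lo = ≤-trans (0≤lo b) (lo≤mid b) ; hi≤1 = hi≤1 b
      ; lo+w≈hi = mid+w≈hi b ; P-lo = P-mid ; Q-hi = Q-hi b }
    choose b (inj₂ Q-mid) = record
      { lo = lo b ; hi = mid b ; 0≤lo = 0≤lo b ; hi≤1 = ≤-trans (mid≤hi b) (hi≤1 b)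
      ; lo+w≈hi = refl ; P-lo = P-lo b ; Q-hi = Q-mid }

    choose-lo : ∀ {k} (b : Bracket k) c → lo b ≤ lo (choose b c)
    choose-lo b (inj₁ _) = lo≤mid b
    choose-lo b (inj₂ _) = ≤-refl

    choose-hi : ∀ {k} (b : Bracket k) c → hi (choose b c) ≤ hi b
    choose-hi b (inj₁ _) = ≤-refl
    choose-hi b (inj₂ _) = mid≤hi b

    cover-mid : ∀ {k} (b : Bracket k) → P (mid b) ⊎ Q (mid b)
    cover-mid b = cover (mid b) (≤-trans (0≤lo b) (lo≤mid b)) (≤-trans (mid≤hi b) (hi≤1 b))

    bracket : ∀ k → Bracket k
    bracket zero    = record
      { lo = 0# ; hi = 1# ; 0≤lo = ≤-refl ; hi≤1 = ≤-refl
      ; lo+w≈hi = +-identityˡ 1# ; P-lo = P0 ; Q-hi = Q1 }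
    bracket (suc k) = choose (bracket k) (cover-mid (bracket k))

    lo-monotone : ∀ {k l} → k ℕ.≤′ l → lo (bracket k) ≤ lo (bracket l)
    lo-monotone ℕ.≤′-refl       = ≤-refl
    lo-monotone (ℕ.≤′-step {n = l} k≤l) =
      ≤-trans (lo-monotone k≤l) (choose-lo (bracket l) (cover-mid (bracket l)))

    hi-antitone : ∀ {k l} → k ℕ.≤′ l → hi (bracket l) ≤ hi (bracket k)
    hi-antitone ℕ.≤′-refl       = ≤-refl
    hi-antitone (ℕ.≤′-step {n = l} k≤l) =
      ≤-trans (choose-hi (bracket l) (cover-mid (bracket l))) (hi-antitone k≤l)

    -- All brackets from `N` on lie inside `bracket N`, which is shorter than `ε`: `lo p < hi p ≤ hi
    -- N = lo N + width N < lo q + ε`.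
    lo-cauchy : Cauchy (lo ∘ bracket)
    lo-cauchy ε 0<ε with width-small ε 0<ε
    ... | N , w<ε = N , λ p q N≤p N≤q → close p q N≤p N≤q , close q p N≤q N≤p
      where
      close : ∀ p q → N ℕ.≤ p → N ℕ.≤ q → lo (bracket p) < lo (bracket q) + ε
      close p q N≤p N≤q = <-trans
        (<-≤-trans (lo<hi (bracket p)) (hi-antitone (ℕ.≤⇒≤′ N≤p)))
        (<-respˡ-≈ (lo+w≈hi (bracket N))
          (+-mono-≤-< (lo-monotone (ℕ.≤⇒≤′ N≤q)) (w<ε N ℕ.≤-refl)))

    opaque
      -- The limit `l` of the left ends lies in `P` or in `Q`. Openness then puts a late end from
      -- the other set into the same one: the left end if `Q l`, the right end if `P l`.
      interval-connected : ∃[ t ] 0# ≤ t × t ≤ 1# × P t × Q t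
      interval-connected with complete (lo ∘ bracket) lo-cauchy
      ... | l , converges = meet (cover l 0≤l l≤1)
        where
        0≤l : 0# ≤ l
        0≤l l<0 with converges (- l)
          (<-via l<0 (solve 1 (λ l → con (+ 0) :- l := :- l :- con (+ 0)) refl l))
        ... | N , near = 0≤lo (bracket N)
          (<-respʳ-≈ (-‿inverseʳ l) (proj₁ (near N ℕ.≤-refl)))
        l≤1 : l ≤ 1#
        l≤1 1<l with converges (l - 1#)
          (<-via 1<l (solve 1 (λ l → l :- con (+ 1) := l :- con (+ 1) :- con (+ 0)) refl l))
        ... | N , near = hi≤1 (bracket N) (<-trans
          (<-via (proj₂ (near N ℕ.≤-refl))
            (solve 2 (λ l a → a :+ (l :- con (+ 1)) :- l := a :- con (+ 1)) refl l (lo (bracket N))))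
          (lo<hi (bracket N)))
        meet : P l ⊎ Q l → ∃[ t ] 0# ≤ t × t ≤ 1# × P t × Q t
        meet (inj₂ Q-l) with Q-open l Q-l
        ... | η , 0<η , near-Q with converges η 0<η
        ...   | N , near = lo b , 0≤lo b , ≤-trans (<⇒≤ (lo<hi b)) (hi≤1 b) ,
                           P-lo b , near-Q (lo b) (near N ℕ.≤-refl)
          where
          b : Bracket N
          b = bracket N
        meet (inj₁ P-l) with P-open l P-l
        ... | η , 0<η , near-P with halve η 0<η
        -- Half of `η` covers the distance from `lo b` to `l`, the other half the width of the
        -- bracket.
        ...   | δ , 0<δ , δ+δ≈η with converges δ 0<δ | width-small δ 0<δ
        ...     | N , near | N′ , w<δ =
          hi b , ≤-trans (0≤lo b) (<⇒≤ (lo<hi b)) , hi≤1 b , near-P (hi b) (hi<l+η , l<hi+η) , Q-hi b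
          where
          p : ℕ
          p = N ℕ.⊔ N′
          b : Bracket p
          b = bracket p
          lo-near : Within δ (lo b) l
          lo-near = near p (ℕ.m≤m⊔n N N′)
          hi<l+η : hi b < l + η
          hi<l+η = <-respˡ-≈ (lo+w≈hi b) (<-respʳ-≈ (trans (+-assoc l δ δ) (+-congˡ δ+δ≈η))
            (+-mono-< (proj₁ lo-near) (w<δ p (ℕ.m≤n⊔m N N′))))
          l<hi+η : l < hi b + η
          l<hi+η = <-trans (proj₂ lo-near) (+-mono-< (lo<hi b) (<-respʳ-≈ δ+δ≈η
            (<-via 0<δ (solve 1 (λ δ → δ :- con (+ 0) := δ :+ δ :- δ) refl δ))))

  opaque
    -- Lipschitz continuity: bounding `d` by `ι k` and `- d` by `ι l` makes `K = ι (suc (k + l))`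
    -- larger than both. The radius is `δ / K`.
    scaling-continuous : ∀ d δ → 0# < δ →
      ∃[ η ] 0# < η × (∀ s t → Within η s t → Within δ (s * d) (t * d))
    scaling-continuous d δ 0<δ with archimedean d | archimedean (- d)
    ... | k , d<k | l , -d<l with 0<⇒inverse (≤-<-trans (ι-mono-≤ {0} {k ℕ.+ l} z≤n) (x<1+x (ι (k ℕ.+ l))))
    ...   | e , 0<e , Ke≈1 = δ * e , *-pos 0<δ 0<e , λ s t (s<t , t<s) →
      close s t s<t t<s , close t s t<s s<t
      where
      K : Carrier
      K = ι (suc (k ℕ.+ l))
      η : Carrier
      η = δ * e
      ηK≈δ : η * K ≈ δ
      ηK≈δ = trans (solve 3 (λ δ e K → δ :* e :* K := δ :* (K :* e)) refl δ e K)
        (trans (*-congˡ Ke≈1) (*-identityʳ δ))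
      0<K-d : 0# < K - d
      0<K-d = <-via (<-≤-trans d<k (ι-mono-≤ (ℕ.m≤n⇒m≤1+n (ℕ.m≤m+n k l))))
        (solve 2 (λ K d → K :- d := K :- d :- con (+ 0)) refl K d)
      0<K+d : 0# < K + d
      0<K+d = <-via (<-≤-trans -d<l (ι-mono-≤ (ℕ.m≤n⇒m≤1+n (ℕ.m≤n+m l k))))
        (solve 2 (λ K d → K :- (:- d) := K :+ d :- con (+ 0)) refl K d)
      half-pos : ∀ {x} → 0# < x + x → 0# < x
      half-pos {x} 0<2x with <-cotrans 0<2x x
      ... | inj₁ 0<x  = 0<x
      ... | inj₂ x<2x = <-via x<2x (solve 1 (λ x → x :+ x :- x := x :- con (+ 0)) refl x)
      -- With τ = s - t: (η - τ)(K + d) + (η + τ)(K - d) = 2 (η K - τ d).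
      close : ∀ s t → s < t + η → t < s + η → s * d < t * d + δ
      close s t s<t t<s = <-via (half-pos (<-via
          (+-mono-< (*-pos (<-via {u = 0#} {v = t + η - s} s<t
              (solve 3 (λ s t η → t :+ η :- s := t :+ η :- s :- con (+ 0)) refl s t η)) 0<K+d)
            (*-pos (<-via {u = 0#} {v = s + η - t} t<s
              (solve 3 (λ s t η → s :+ η :- t := s :+ η :- t :- con (+ 0)) refl s t η)) 0<K-d))
          (solve 5 (λ s t η K d →
               (t :+ η :- s) :* (K :+ d) :+ (s :+ η :- t) :* (K :- d) :- (con (+ 0) :+ con (+ 0))
            := (t :* d :+ η :* K :- s :* d) :+ (t :* d :+ η :* K :- s :* d) :- con (+ 0))
            refl s t η K d)))
        (trans (solve 3 (λ a b c → b :+ c :- a :- con (+ 0) := b :+ c :- a) refl (s * d) (t * d) (η * K))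
          (+-congʳ (+-congˡ ηK≈δ)))

  Within-mono : ∀ {η δ x y} → η < δ → Within η x y → Within δ x y
  Within-mono η<δ (x<y , y<x) = <-trans x<y (+-monoʳ-< _ η<δ) , <-trans y<x (+-monoʳ-< _ η<δ)

  opaque
    scalings-continuous : ∀ {N} (d : Fin N → Carrier) δ → 0# < δ →
      ∃[ η ] 0# < η × (∀ s t → Within η s t → ∀ l → Within δ (s * d l) (t * d l))
    scalings-continuous {zero}  d δ 0<δ = 1# , 0<1 , λ _ _ _ ()
    scalings-continuous {suc N} d δ 0<δ with scaling-continuous (d zero) δ 0<δ
    ... | η , 0<η , near with scalings-continuous (d ∘ suc) δ 0<δ
    ...   | η′ , 0<η′ , near′ with below-both 0<η 0<η′
    ...     | ζ , 0<ζ , ζ<η , ζ<η′ = ζ , 0<ζ , λ where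
      s t close zero    → near s t (Within-mono ζ<η close)
      s t close (suc l) → near′ s t (Within-mono ζ<η′ close) l

-- Tableaux of decreasing sequences of points; injectivity of row sums.

≤⇒inject₁ : ∀ {n} (j : Fin (suc n)) (l : Fin n) → toℕ j ℕ.≤ toℕ l →
  ∃[ k ] inject₁ k ≡ j × k Fin.≤ l
≤⇒inject₁ zero    zero    _         = zero , ≡.refl , z≤n
≤⇒inject₁ zero    (suc l) _         = zero , ≡.refl , z≤n
≤⇒inject₁ (suc j) (suc l) (s≤s j≤l) =
  let k , eq , k≤l = ≤⇒inject₁ j l j≤l in suc k , ≡.cong suc eq , s≤s k≤l

module Tableaux (ℝ : RealNumbers) (m : ℕ) where
  open RealNumbers ℝ
  open RealProperties ℝ
  open Reals ℝ
  open Counting ℝ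

  -- The inequalities are strict because points avoid the hyperplanes, and the top interval `k = t`
  -- is unbounded. The cap `t` varies to allow the induction in `count-block-entry`.
  EntryUpTo : ℕ → Carrier → ℕ → Set
  EntryUpTo t d k = k ℕ.≤ t × ι k < d × (k ℕ.< t → d < ι (suc k))

  Entry : Carrier → ℕ → Set
  Entry = EntryUpTo m

  entry-resp-≈ : ∀ {d e k} → d ≈ e → Entry d k → Entry e k
  entry-resp-≈ d≈e (k≤m , k<d , d<) =
    k≤m , <-respʳ-≈ d≈e k<d , λ k<m → <-respˡ-≈ d≈e (d< k<m)

  entry-mono : ∀ {d e k l} → d ≤ e → Entry d k → Entry e l → k ℕ.≤ l
  entry-mono d≤e (k≤m , k<d , _) (_ , _ , e<) = ℕ.≮⇒≥ λ l<k →
    d≤e (<-trans (e< (ℕ.<-≤-trans l<k k≤m)) (≤-<-trans (ι-mono-≤ l<k) k<d))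

  entry-unique : ∀ {d k l} → Entry d k → Entry d l → k ≡ l
  entry-unique K L = ℕ.≤-antisym (entry-mono ≤-refl K L) (entry-mono ≤-refl L K)

  entry-apart : ∀ {d k} → Entry d k → ∀ l → l ℕ.≤ m → d # ι l
  entry-apart {k = k} (_ , k<d , d<) l l≤m with l ℕ.≤? k
  ... | yes l≤k = inj₂ (≤-<-trans (ι-mono-≤ l≤k) k<d)
  ... | no  l≰k = inj₁ (<-≤-trans (d< (ℕ.<-≤-trans (ℕ.≰⇒> l≰k) l≤m)) (ι-mono-≤ (ℕ.≰⇒> l≰k)))

  entry-pos : ∀ {d k} → Entry d k → 0# < d
  entry-pos {k = k} (_ , k<d , _) = ≤-<-trans (ι-mono-≤ {0} {k} z≤n) k<d

  -- The points x₀ > x₁ > … > xₙ and the tableau T of the region containing them,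
  -- padded with zeros below the diagonal.
  record IsTableau {n} (x : Fin (suc n) → Carrier) (T : Fin n → Fin n → ℕ) : Set where
    field
      entry : ∀ i j → i Fin.≤ j → Entry (x (inject₁ i) - x (suc j)) (T i j)
      empty : ∀ i j → j Fin.< i → T i j ≡ 0
  open IsTableau

  tail : ∀ {n x T} → IsTableau {suc n} x T →
    IsTableau (x ∘ suc) (λ i j → T (suc i) (suc j))
  tail t .entry i j i≤j = t .entry (suc i) (suc j) (s≤s i≤j)
  tail t .empty i j j<i = t .empty (suc i) (suc j) (s≤s j<i)

  sum-row-suc : ∀ {n x T} → IsTableau {suc n} x T →
    ∀ i → sumℕ (T (suc i)) ≡ sumℕ (T (suc i) ∘ suc)
  sum-row-suc {T = T} t i = ≡.cong (ℕ._+ sumℕ (T (suc i) ∘ suc)) (t .empty (suc i) zero (s≤s z≤n))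

  tableau-unique : ∀ {n} {x : Fin (suc n) → Carrier} {T U} → IsTableau x T → IsTableau x U →
    ∀ i j → T i j ≡ U i j
  tableau-unique t u i j with i Fin.≤? j
  ... | yes i≤j = entry-unique (t .entry i j i≤j) (u .entry i j i≤j)
  ... | no  i≰j = ≡.trans (t .empty i j (ℕ.≰⇒> i≰j)) (≡.sym (u .empty i j (ℕ.≰⇒> i≰j)))

  -- After removal of common initial points the upper row is the first one. There `x₀ - z` exceeds
  -- `y - z` by `x₀ - y > 0`, and entries are monotone in the difference.
  rows-decreasing : ∀ {n x T} → IsTableau {n} x T →
    ∀ {i i′} → i Fin.≤ i′ → ∀ j → T i′ j ℕ.≤ T i j
  rows-decreasing t {zero} {zero} _ j = ℕ.≤-refl
  rows-decreasing t {zero} {suc i′} _ zero rewrite t .empty (suc i′) zero (s≤s z≤n) = z≤n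
  rows-decreasing {x = x} t {zero} {suc i′} _ (suc j) with i′ Fin.≤? j
  ... | no i′≰j rewrite t .empty (suc i′) (suc j) (s≤s (ℕ.≰⇒> i′≰j)) = z≤n
  ... | yes i′≤j = entry-mono (<⇒≤ (<-via (entry-pos (t .entry zero (inject₁ i′) z≤n))
          (solve 3 (λ x y z → x :- y :- con (+ 0) := x :- z :- (y :- z)) refl
            (x zero) (x (suc (inject₁ i′))) (x (suc (suc j))))))
        (t .entry (suc i′) (suc j) (s≤s i′≤j)) (t .entry zero (suc j) z≤n)
  rows-decreasing t {suc i} {suc i′} _ zero rewrite t .empty (suc i′) zero (s≤s z≤n) = z≤n
  rows-decreasing t {suc i} {suc i′} (s≤s i≤i′) (suc j) = rows-decreasing (tail t) i≤i′ j

  row-bounded : ∀ {n x T} → IsTableau {n} x T → ∀ i → sumℕ (T i) ℕ.≤ m ℕ.* (n ∸ toℕ i)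
  row-bounded t zero = sum-≤-* m λ j → proj₁ (t .entry zero j z≤n)
  row-bounded t (suc i) rewrite sum-row-suc t i = row-bounded (tail t) i

  -- The crossing entries force q - r and q′ - r′ to opposite sides of the hyperplane at
  -- height c - a - 1, although both have entry t.
  uncrossed : ∀ {p q r p′ q′ r′ t a b c d} →
    Entry (q - r) t → Entry (q′ - r′) t →
    Entry (p - q) a → Entry (p′ - q′) b → Entry (p - r) c → Entry (p′ - r′) d →
    a ℕ.< b → d ℕ.< c → ⊥
  uncrossed {p} {q} {r} {p′} {q′} {r′} {t} {a} {b} {c} {d}
    (_ , _ , qr<) (_ , t<q′r′ , _) (_ , _ , pq<) (b≤m , b<p′q′ , _)
    (c≤m , c<pr , _) (_ , _ , p′r′<) a<b d<c = ℕ.<-irrefl ≡.refl (begin-strict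
      c              ≤⟨ ℕ.s≤s⁻¹ (ι-cancel-< (<-respʳ-≈ (sym (ι-+ (suc t) (suc a))) c<)) ⟩
      t ℕ.+ suc a    ≤⟨ ℕ.+-monoʳ-≤ t a<b ⟩
      t ℕ.+ b        ≤⟨ t+b≤d ⟩
      d              <⟨ d<c ⟩
      c              ∎)
    where
    open ℕ.≤-Reasoning
    t+b≤d : t ℕ.+ b ℕ.≤ d
    t+b≤d = ℕ.s≤s⁻¹ (ι-cancel-< (<-respˡ-≈ (sym (ι-+ t b))
      (<-trans (<-via (+-mono-< t<q′r′ b<p′q′)
        (solve 5 (λ p q r t b → (q :- r) :+ (p :- q) :- (t :+ b) := (p :- r) :- (t :+ b))
          refl p′ q′ r′ (ι t) (ι b)))
        (p′r′< (ℕ.<-≤-trans d<c c≤m)))))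
    -- The entry `t` bounds `q - r` from above only if it is not the top one, which
    -- `t ≤ t + b ≤ d < c ≤ m` ensures.
    t<m : t ℕ.< m
    t<m = ℕ.≤-<-trans (ℕ.≤-trans (ℕ.m≤m+n t b) t+b≤d) (ℕ.<-≤-trans d<c c≤m)
    c< : ι c < ι (suc t) + ι (suc a)
    c< = <-trans c<pr (<-via (+-mono-< (qr< t<m) (pq< (ℕ.<-≤-trans a<b b≤m)))
      (solve 5 (λ p q r t a → (t :+ a) :- ((q :- r) :+ (p :- q)) := (t :+ a) :- (p :- r))
        refl p q r (ι (suc t)) (ι (suc a))))

  -- Induction identifies all rows but the first; the first rows then have equal sums and cannot
  -- cross.
  row-sums-injective : ∀ {n x y T U} → IsTableau {n} x T → IsTableau y U →
    (∀ i → sumℕ (T i) ≡ sumℕ (U i)) → ∀ i j → T i j ≡ U i j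
  row-sums-injective {suc n} {x} {y} {T} {U} t u ΣT≡ΣU = λ where
      zero            → sum≡∧uncrossed⇒≡ (ΣT≡ΣU zero) first-row
      (suc i) zero    → ≡.trans (t .empty (suc i) zero (s≤s z≤n)) (≡.sym (u .empty (suc i) zero (s≤s z≤n)))
      (suc i) (suc j) → tails i j
    where
    tails : ∀ i j → T (suc i) (suc j) ≡ U (suc i) (suc j)
    tails = row-sums-injective (tail t) (tail u) λ i →
      ≡.trans (≡.sym (sum-row-suc t i)) (≡.trans (ΣT≡ΣU (suc i)) (sum-row-suc u i))
    -- For `j < l` the points in columns `j` and `l` differ by a root of the remaining tableau,
    -- where `T` and `U` agree; its entry is the shared `t` of `uncrossed`. The order `l < j`
    -- follows by exchanging `t` and `u`.
    ordered : ∀ {x y T U} → IsTableau {suc n} x T → IsTableau y U →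
      (∀ i j → T (suc i) (suc j) ≡ U (suc i) (suc j)) →
      ∀ j l → j Fin.< l → T zero j ℕ.< U zero j → U zero l ℕ.< T zero l → ⊥
    ordered {y = y} t u same j (suc l) (s≤s j≤l) with ≤⇒inject₁ j l j≤l
    ... | k , ≡.refl , k≤l = uncrossed
      (t .entry (suc k) (suc l) (s≤s k≤l))
      (≡.subst (Entry (y (suc (inject₁ k)) - y (suc (suc l)))) (≡.sym (same k l))
        (u .entry (suc k) (suc l) (s≤s k≤l)))
      (t .entry zero (inject₁ k) z≤n) (u .entry zero (inject₁ k) z≤n)
      (t .entry zero (suc l) z≤n) (u .entry zero (suc l) z≤n)
    first-row : ∀ j l → T zero j ℕ.< U zero j → U zero l ℕ.< T zero l → ⊥
    first-row j l Tj<Uj Ul<Tl with Fin.<-cmp j l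
    ... | tri< j<l _ _ = ordered t u tails j l j<l Tj<Uj Ul<Tl
    ... | tri≈ _ ≡.refl _ = ℕ.<-asym Tj<Uj Ul<Tl
    ... | tri> _ _ l<j = ordered u t (λ i j → ≡.sym (tails i j)) l j l<j Ul<Tl Tj<Uj

  -- Thresholds, and the realization of a prescribed first row sum.

  block : Carrier → ℕ → List Carrier
  block q zero    = []
  block q (suc t) = q + ι (suc t) ∷ block q t

  block-all : ∀ {P : Carrier → Set} q t → (∀ l → 1 ℕ.≤ l → l ℕ.≤ t → P (q + ι l)) →
    All P (block q t)
  block-all q zero    p = []
  block-all q (suc t) p =
    p (suc t) (s≤s z≤n) ℕ.≤-refl ∷ block-all q t λ l 1≤l l≤t → p l 1≤l (ℕ.m≤n⇒m≤1+n l≤t)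

  opaque
    block-apart : ∀ q t → AllPairs _#_ (block q t)
    block-apart q zero    = []
    block-apart q (suc t) = block-all q t (λ l _ l≤t → inj₂ (+-monoʳ-< q (ι-mono-< (s≤s l≤t))))
      ∷ block-apart q t

  block-length : ∀ q t → length (block q t) ≡ t
  block-length q zero    = ≡.refl
  block-length q (suc t) = ≡.cong suc (block-length q t)

  count-block-self : ∀ {q} t {k} → Count q (block q t) k → k ≡ 0
  count-block-self zero    []           = ≡.refl
  count-block-self {q} (suc t) (below <q _) = ⊥-elim (≤-via (ι-mono-≤ {0} {suc t} z≤n)
    (solve 2 (λ q i → i :- con (+ 0) := q :+ i :- q) refl q (ι (suc t))) <q)
  count-block-self (suc t) (above _ c)  = count-block-self t c

  -- The count is the integer part of `y - q` capped at `t`. If the new threshold `q + t + 1` is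
  -- below `y`, the old entry must have been the top one `t`; if it is above, it closes the formerly
  -- unbounded top interval.
  count-block-entry : ∀ {y q} t {k} → q < y → Count y (block q t) k → EntryUpTo t (y - q) k
  count-block-entry {y} {q} zero q<y [] =
    z≤n , <-via q<y (solve 2 (λ y q → y :- q := y :- q :- con (+ 0)) refl y q) , λ ()
  count-block-entry {y} {q} (suc t) q<y (below q+t<y c)
    with count-block-entry t q<y c
  ... | k≤t , k<y-q , y-q< with ℕ.m≤n⇒m<n∨m≡n k≤t
  ...   | inj₁ k<t = ⊥-elim (ι-mono-≤ (ℕ.m≤n⇒m≤1+n k<t) (<-trans t<y-q (y-q< k<t)))
    where
    t<y-q : ι (suc t) < y - q
    t<y-q = <-via q+t<y (solve 3 (λ y q i → y :- (q :+ i) := y :- q :- i) refl y q (ι (suc t)))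
  ...   | inj₂ ≡.refl = ℕ.≤-refl ,
    <-via q+t<y (solve 3 (λ y q i → y :- (q :+ i) := y :- q :- i) refl y q (ι (suc t))) ,
    λ t<t → ⊥-elim (ℕ.<-irrefl ≡.refl t<t)
  count-block-entry {y} {q} (suc t) {k} q<y (above y<q+t c)
    with count-block-entry t q<y c
  ... | k≤t , k<y-q , y-q< = ℕ.m≤n⇒m≤1+n k≤t , k<y-q , λ _ → upper
    where
    upper : y - q < ι (suc k)
    upper with ℕ.m≤n⇒m<n∨m≡n k≤t
    ... | inj₁ k<t    = y-q< k<t
    ... | inj₂ ≡.refl = <-via y<q+t
      (solve 3 (λ y q i → q :+ i :- y := i :- (y :- q)) refl y q (ι (suc t)))

  thresholds : ∀ {N} → (Fin N → Carrier) → List Carrier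
  thresholds {zero}  x = []
  thresholds {suc N} x = block (x zero) m ++ thresholds (x ∘ suc)

  thresholds-all : ∀ {P : Carrier → Set} {N} (x : Fin N → Carrier) →
    (∀ j l → 1 ℕ.≤ l → l ℕ.≤ m → P (x j + ι l)) → All P (thresholds x)
  thresholds-all {N = zero}  x p = []
  thresholds-all {N = suc N} x p =
    All.++⁺ (block-all (x zero) m (p zero)) (thresholds-all (x ∘ suc) (p ∘ suc))

  thresholds-length : ∀ {N} (x : Fin N → Carrier) → length (thresholds x) ≡ N ℕ.* m
  thresholds-length {zero}  x = ≡.refl
  thresholds-length {suc N} x = ≡.trans (length-++ (block (x zero) m))
    (≡.cong₂ ℕ._+_ (block-length (x zero) m) (thresholds-length (x ∘ suc)))

  count-thresholds : ∀ {N} {x : Fin N → Carrier} {y s} → Count y (thresholds x) s →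
    ∃[ r ] sumℕ r ≡ s × (∀ j → Count y (block (x j) m) (r j))
  count-thresholds {zero} [] = (λ ()) , ≡.refl , λ ()
  count-thresholds {suc N} {x} c with count-++ (block (x zero) m) c
  ... | a , b , ≡.refl , ca , cb with count-thresholds cb
  ...   | r , Σr≡b , cr = a Vector.∷ r , ≡.cong (a ℕ.+_) Σr≡b , λ where
    zero    → ca
    (suc j) → cr j

  -- For `l′ ≤ l` this follows from `p > q`. Otherwise it says that `p - q` avoids height
  -- `l′ - l ≤ m`, which is one of the hyperplanes.
  shifts-apart : ∀ {p q k} → Entry (p - q) k → ∀ l l′ → l′ ℕ.≤ m → p + ι l # q + ι l′
  shifts-apart {p} {q} K l l′ l′≤m with ℕ.≤-total l l′
  ... | inj₂ l′≤l = inj₂ (<-via (+-mono-≤-< (ι-mono-≤ l′≤l) (entry-pos K))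
    (solve 4 (λ p q i i′ → (i :+ (p :- q)) :- (i′ :+ con (+ 0)) := p :+ i :- (q :+ i′)) refl
      p q (ι l) (ι l′)))
  ... | inj₁ l≤l′ = Sum.map
    (λ p-q< → <-via p-q< (trans (solve 4 (λ p q i e → e :- (p :- q) := q :+ (e :+ i) :- (p :+ i))
        refl p q (ι l) (ι (l′ ∸ l))) (+-congʳ (+-congˡ shift))))
    (λ <p-q → <-via <p-q (trans (solve 4 (λ p q i e → (p :- q) :- e := p :+ i :- (q :+ (e :+ i)))
        refl p q (ι l) (ι (l′ ∸ l))) (+-congˡ (-‿cong (+-congˡ shift)))))
    (entry-apart K (l′ ∸ l) (ℕ.≤-trans (ℕ.m∸n≤m l′ l) l′≤m))
    where
    shift : ι (l′ ∸ l) + ι l ≈ ι l′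
    shift = trans (sym (ι-+ (l′ ∸ l) l)) (reflexive (≡.cong ι (ℕ.m∸n+n≡m l≤l′)))

  -- Matching `n` against `suc` provides row `zero`; later lemmas need not repeat the split.
  first-entry : ∀ {n x T} → IsTableau {n} x T → ∀ j → ∃[ k ] Entry (x zero - x (suc j)) k
  first-entry {suc n} t j = _ , t .entry zero j z≤n

  opaque
    first-greatest : ∀ {n x T} → IsTableau {n} x T → ∀ j → x (suc j) < x zero
    first-greatest {x = x} t j = <-via (entry-pos (proj₂ (first-entry t j)))
      (solve 2 (λ p q → p :- q :- con (+ 0) := p :- q) refl (x zero) (x (suc j)))

  thresholds-apart : ∀ {n x T} → IsTableau {n} x T → AllPairs _#_ (thresholds x)
  thresholds-apart {n} {x} t = AllPairs.++⁺ (block-apart (x zero) m) (later t)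
    (block-all (x zero) m λ l _ _ → thresholds-all (x ∘ suc) λ j l′ _ l′≤m →
      shifts-apart (proj₂ (first-entry t j)) l l′ l′≤m)
    where
    later : ∀ {n x T} → IsTableau {n} x T → AllPairs _#_ (thresholds (x ∘ suc))
    later {zero}  t = []
    later {suc n} t = thresholds-apart (tail t)

  opaque
    first-apart : ∀ {n x T} → IsTableau {n} x T → All (x zero #_) (thresholds x)
    first-apart {x = x} t = thresholds-all x λ where
      zero    (suc l) _ _  → inj₁ (<-via (ι-mono-< {0} {suc l} (s≤s z≤n))
        (solve 2 (λ p i → i :- con (+ 0) := p :+ i :- p) refl (x zero) (ι (suc l))))
      (suc j) l _ l≤m → Sum.map (<-respˡ-≈ (+-identityʳ _)) (<-respʳ-≈ (+-identityʳ _))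
        (shifts-apart (proj₂ (first-entry t j)) 0 l l≤m)

  -- No threshold of `x zero` lies below it, and those of the other points contribute the first row
  -- of `T`. Without other points the count is 0.
  count-first : ∀ {n x T s k} → IsTableau {n} x T → (∀ i → sumℕ (T i) ℕ.≤ s) →
    Count (x zero) (thresholds x) k → k ℕ.≤ s
  count-first {x = x} t ΣT≤s c with count-++ (block (x zero) m) c
  ... | a , b , ≡.refl , ca , cb rewrite count-block-self m ca = later t ΣT≤s cb
    where
    later : ∀ {n x T s k} → IsTableau {n} x T → (∀ i → sumℕ (T i) ℕ.≤ s) →
      Count (x zero) (thresholds (x ∘ suc)) k → k ℕ.≤ s
    later {zero} _ _ [] = z≤n
    later {suc n} {x} t ΣT≤s c with count-thresholds c
    ... | r , Σr≡k , cr = ℕ.≤-trans (ℕ.≤-reflexive (≡.sym Σr≡k)) (ℕ.≤-trans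
      (sum-mono-≤ λ j → entry-mono ≤-refl
        (count-block-entry m (first-greatest t j) (cr j)) (t .entry zero j z≤n))
      (ΣT≤s zero))

  extend : ∀ {n} → (Fin (suc n) → ℕ) → (Fin n → Fin n → ℕ) → Fin (suc n) → Fin (suc n) → ℕ
  extend r T zero    j       = r j
  extend r T (suc i) zero    = 0
  extend r T (suc i) (suc j) = T i j

  first<⇒all< : ∀ {n x T y} → IsTableau {n} x T → x zero < y → ∀ j → x j < y
  first<⇒all< t x₀<y zero    = x₀<y
  first<⇒all< t x₀<y (suc j) = <-trans (first-greatest t j) x₀<y

  first-row-realizable : ∀ {n x T s} → IsTableau {n} x T →
    (∀ i → sumℕ (T i) ℕ.≤ s) → s ℕ.≤ m ℕ.* suc n →
    ∃[ y ] ∃[ r ] IsTableau (y Vector.∷ x) (extend r T) × sumℕ r ≡ s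
  -- Prepending `x zero` to the thresholds and raising the target to `suc s` forces the new point
  -- above `x zero`.
  first-row-realizable {n} {x} {T} {s} t ΣT≤s s≤ with
    every-count-attained (first-apart t ∷ thresholds-apart t) (suc s)
      (s≤s (ℕ.≤-trans s≤ (ℕ.≤-reflexive (≡.trans (ℕ.*-comm m (suc n)) (≡.sym (thresholds-length x))))))
  -- Otherwise `suc s` thresholds lie below `y`, hence below `x zero`, where there are at most `s`.
  ... | y , above y<x₀ c = let _ , d = count (first-apart t) in
    ⊥-elim (ℕ.<-irrefl ≡.refl (ℕ.≤-trans (count-mono (<⇒≤ y<x₀) c d) (count-first t ΣT≤s d)))
  ... | y , below x₀<y c with count-thresholds c
  ...   | r , Σr≡s , cr = y , r , extended , Σr≡s
    where
    extended : IsTableau (y Vector.∷ x) (extend r T)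
    extended .entry zero    j       _         = count-block-entry m (first<⇒all< t x₀<y j) (cr j)
    extended .entry (suc i) (suc j) (s≤s i≤j) = t .entry i j i≤j
    extended .empty (suc i) zero    _         = ≡.refl
    extended .empty (suc i) (suc j) (s≤s j<i) = t .empty i j j<i

  -- The points are placed from the last to the first. Their sum is arbitrary until `translate`
  -- centres them.
  row-sums-surjective : ∀ {n} (p : Fin n → ℕ) → (∀ {i j} → i Fin.≤ j → p j ℕ.≤ p i) →
    (∀ i → p i ℕ.≤ m ℕ.* (n ∸ toℕ i)) →
    ∃[ x ] ∃[ T ] IsTableau x T × (∀ i → sumℕ (T i) ≡ p i)
  row-sums-surjective {zero} p _ _ =
    (λ _ → 0#) , (λ ()) , record { entry = λ () ; empty = λ () } , λ ()
  row-sums-surjective {suc n} p decreasing bounded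
    with row-sums-surjective (p ∘ suc) (decreasing ∘ s≤s) (bounded ∘ suc)
  ... | x , T , t , ΣT≡p
    with first-row-realizable t
      (λ i → ℕ.≤-trans (ℕ.≤-reflexive (ΣT≡p i)) (decreasing {zero} {suc i} z≤n)) (bounded zero)
  ...   | y , r , t′ , Σr≡p₀ = y Vector.∷ x , extend r T , t′ , λ where
    zero    → Σr≡p₀
    (suc i) → ΣT≡p i

-- Segments in `V` and connectedness of convex sets.

module Regions (ℝ : RealNumbers) (n m : ℕ) where
  open RealNumbers ℝ
  open RealProperties ℝ
  open Reals ℝ
  open IntervalConnectedness ℝ
  open Catalan ℝ n m
  open Tableaux ℝ m
  open IsTableau
  open RealSum +-commutativeMonoid using (sum)

  opaque
    sum-segment : ∀ {N} (x y : Fin N → Carrier) t →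
      sum (λ l → x l + t * (y l - x l)) ≈ sum x + t * (sum y - sum x)
    sum-segment {zero}  x y t = solve 1 (λ t → con (+ 0)
      := con (+ 0) :+ t :* (con (+ 0) :- con (+ 0))) refl t
    sum-segment {suc N} x y t = trans (+-congˡ (sum-segment (x ∘ suc) (y ∘ suc) t))
      (solve 5 (λ t x₀ y₀ x y → x₀ :+ t :* (y₀ :- x₀) :+ (x :+ t :* (y :- x))
                             := x₀ :+ x :+ t :* (y₀ :+ y :- (x₀ :+ x))) refl
        t (x zero) (y zero) (sum (x ∘ suc)) (sum (y ∘ suc)))

  segment : V → V → Carrier → V
  segment x y t .coord l = coord x l + t * (coord y l - coord x l)
  segment x y t .sum≈0 = trans (sum-segment (coord x) (coord y) t)
    (trans (+-cong (sum≈0 x) (*-congˡ (+-cong (sum≈0 y) (-‿cong (sum≈0 x)))))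
      (solve 1 (λ t → con (+ 0) :+ t :* (con (+ 0) :- con (+ 0)) := con (+ 0)) refl t))

  SegmentClosed : Pred V 0ℓ → Set
  SegmentClosed C = ∀ x y → x ∈ C → y ∈ C → ∀ t → 0# ≤ t → t ≤ 1# → segment x y t ∈ C

  -- Predicates on `V` need not respect `_≈_`, but balls do. This is used at the ends of a segment,
  -- which equal `x` and `y` only up to `_≈_`.
  open-resp-≈ : ∀ {A} → IsOpen A → ∀ {x y} → (∀ l → coord x l ≈ coord y l) → x ∈ A → y ∈ A
  open-resp-≈ A-open {x} {y} x≈y x∈A with A-open x x∈A
  ... | δ , 0<δ , near = near y λ l → shift (x≈y l) , shift (sym (x≈y l))
    where
    shift : ∀ {a b} → a ≈ b → a < b + δ
    shift {a} {b} a≈b = <-respˡ-≈ (sym a≈b)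
      (<-via 0<δ (solve 2 (λ b δ → δ :- con (+ 0) := b :+ δ :- b) refl b δ))

  open-segment : ∀ {A} → IsOpen A → ∀ x y → Open (λ t → segment x y t ∈ A)
  open-segment A-open x y t t∈A with A-open (segment x y t) t∈A
  ... | δ , 0<δ , near with scalings-continuous (λ l → coord y l - coord x l) δ 0<δ
  ...   | η , 0<η , close = η , 0<η , λ s s~t → near (segment x y s) λ l →
    let s<t , t<s = close s t s~t l in shift t<s , shift s<t
    where
    shift : ∀ {a b c} → a < b + δ → c + a < c + b + δ
    shift {a} {b} {c} a<b+δ = <-respʳ-≈ (sym (+-assoc c b δ)) (+-monoʳ-< c a<b+δ)

  -- `A` and `B` are pulled back along the segment from `x` to `y`, where `interval-connected`
  -- yields a common parameter.
  segmentClosed⇒connected : ∀ {C} → SegmentClosed C → IsConnected C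
  segmentClosed⇒connected {C} closed A B A-open B-open cover (x , x∈C , x∈A) (y , y∈C , y∈B) empty
    with interval-connected (open-segment A-open x y) (open-segment B-open x y)
      (λ t 0≤t t≤1 → cover {segment x y t} (closed x y x∈C y∈C t 0≤t t≤1))
      (open-resp-≈ A-open (λ l → solve 2 (λ a b → a := a :+ con (+ 0) :* (b :- a)) refl
        (coord x l) (coord y l)) x∈A)
      (open-resp-≈ B-open (λ l → solve 2 (λ a b → b := a :+ con (+ 1) :* (b :- a)) refl
        (coord x l) (coord y l)) y∈B)
  ... | t , 0≤t , t≤1 , t∈A , t∈B =
    empty (segment x y t) (closed x y x∈C y∈C t 0≤t t≤1 , t∈A , t∈B)

  -- Cells of tableaux as dominant regions.

  Cell : (Fin n → Fin n → ℕ) → Pred V 0ℓ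
  Cell T v = IsTableau (coord v) T

  -- The gap to each bound of the interval is affine in `t` and positive at both ends, so
  -- `convex-pos` applies.
  entry-convex : ∀ {a b c d k} → Entry (a - b) k → Entry (c - d) k →
    ∀ t → 0# ≤ t → t ≤ 1# → Entry ((a + t * (c - a)) - (b + t * (d - b))) k
  entry-convex {a} {b} {c} {d} {k} (k≤m , k<ab , ab<) (_ , k<cd , cd<) t 0≤t t≤1 = k≤m ,
    <-via (convex-pos (gap k<ab) (gap k<cd) 0≤t t≤1) (solve 6 (λ a b c d t i →
      (a :- b :- i) :+ t :* ((c :- d :- i) :- (a :- b :- i)) :- con (+ 0)
      := (a :+ t :* (c :- a)) :- (b :+ t :* (d :- b)) :- i) refl a b c d t (ι k)) ,
    λ k<m → <-via (convex-pos (gap (ab< k<m)) (gap (cd< k<m)) 0≤t t≤1) (solve 6 (λ a b c d t i →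
      (i :- (a :- b)) :+ t :* ((i :- (c :- d)) :- (i :- (a :- b))) :- con (+ 0)
      := i :- ((a :+ t :* (c :- a)) :- (b :+ t :* (d :- b)))) refl a b c d t (ι (suc k)))
    where
    gap : ∀ {x y} → x < y → 0# < y - x
    gap {x} {y} x<y = <-via x<y (solve 2 (λ x y → y :- x := y :- x :- con (+ 0)) refl x y)

  cell-segmentClosed : ∀ T → SegmentClosed (Cell T)
  cell-segmentClosed T _ _ x∈ y∈ t 0≤t t≤1 .entry i j i≤j =
    entry-convex (x∈ .entry i j i≤j) (y∈ .entry i j i≤j) t 0≤t t≤1
  cell-segmentClosed T _ _ x∈ y∈ t 0≤t t≤1 .empty = x∈ .empty

  pairing-entry : ∀ {T} v → v ∈ Cell T → ∀ i j → i Fin.≤ j → Entry ⟨ coord v , α i j ⟩ (T i j)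
  pairing-entry v v∈ i j i≤j = entry-resp-≈ (sym (pairing (coord v) i j)) (v∈ .entry i j i≤j)

  cell⊆complement : ∀ T → Cell T ⊆ Complement
  cell⊆complement T {v} v∈ i j i≤j = entry-apart (pairing-entry {T} v v∈ i j i≤j)

  not-separated : ∀ {C} → IsConnected C → C ⊆ Complement → ∀ x y → x ∈ C → y ∈ C →
    ∀ i j → i Fin.≤ j → ∀ k → k ℕ.≤ m → ⟨ coord x , α i j ⟩ < ι k → ι k < ⟨ coord y , α i j ⟩ → ⊥
  not-separated connected ⊆complement x y x∈C y∈C i j i≤j k k≤m x<k k<y =
    connected (below i j (ι k)) (above i j (ι k)) (below-open i j (ι k)) (above-open i j (ι k))
      (λ {z} z∈C → ⊆complement {z} z∈C i j i≤j k k≤m) (x , x∈C , x<k) (y , y∈C , k<y)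
      λ _ (_ , z<k , k<z) → <-asym z<k k<z

  -- A connected set in the complement is not separated by any hyperplane, so each point `y` of `C`
  -- lies on the same sides as `v`, and these sides determine the entries.
  cell-maximal : ∀ {T} v → v ∈ Cell T → ∀ C → IsConnected C → C ⊆ Complement →
    Cell T ⊆ C → C ⊆ Cell T
  cell-maximal {T} v v∈ C connected ⊆complement cell⊆C {y} y∈C = λ where
      .entry i j i≤j → let k≤m , k<v , v< = pairing-entry {T} v v∈ i j i≤j in
        entry-resp-≈ (pairing (coord y) i j)
          (k≤m , above-side i j i≤j k≤m k<v , λ k<m → below-side i j i≤j k<m (v< k<m))
      .empty → v∈ .empty
    where
    above-side : ∀ i j → i Fin.≤ j → ∀ {k} → k ℕ.≤ m →
      ι k < ⟨ coord v , α i j ⟩ → ι k < ⟨ coord y , α i j ⟩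
    above-side i j i≤j {k} k≤m k<v with ⊆complement {y} y∈C i j i≤j k k≤m
    ... | inj₂ k<y = k<y
    ... | inj₁ y<k = ⊥-elim (not-separated connected ⊆complement y v y∈C (cell⊆C {v} v∈) i j i≤j k k≤m y<k k<v)
    below-side : ∀ i j → i Fin.≤ j → ∀ {k} → k ℕ.≤ m →
      ⟨ coord v , α i j ⟩ < ι k → ⟨ coord y , α i j ⟩ < ι k
    below-side i j i≤j {k} k≤m v<k with ⊆complement {y} y∈C i j i≤j k k≤m
    ... | inj₁ y<k = y<k
    ... | inj₂ k<y = ⊥-elim (not-separated connected ⊆complement v y (cell⊆C {v} v∈) y∈C i j i≤j k k≤m v<k k<y)

  cellRegion : ∀ {T} v → v ∈ Cell T → DominantRegion
  cellRegion {T} v v∈ = record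
    { points   = Cell T
    ; isRegion = record
      { inhabited  = v , v∈
      ; complement = λ {x} → cell⊆complement T {x}
      ; connected  = segmentClosed⇒connected (cell-segmentClosed T)
      ; maximal    = cell-maximal v v∈
      }
    ; dominant = λ {x} x∈ i j i≤j → <⇒≤ (entry-pos (pairing-entry {T} x x∈ i j i≤j))
    }

  -- Identification of regions with cells, and the bijection.

  shiTableau : DominantRegion → Fin n → Fin n → ℕ
  shiTableau R i j = shiOrZero R i j (i Fin.≤? j)

  -- The weak bounds of a Shi entry become strict because the region avoids the hyperplanes.
  shiEntry⇒entry : ∀ R {i j k} → i Fin.≤ j → IsShiEntry R i j k →
    ∀ x → x ∈ points R → Entry (coord x (inject₁ i) - coord x (suc j)) k
  shiEntry⇒entry R {i} {j} {k} i≤j (k≤m , bounds) x x∈R =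
      entry-resp-≈ (pairing (coord x) i j) (k≤m , k<x , x<)
    where
    lower : ι k ≤ ⟨ coord x , α i j ⟩
    lower with ℕ.m≤n⇒m<n∨m≡n k≤m
    ... | inj₁ k<m    = proj₁ (proj₁ (bounds x x∈R) k<m)
    ... | inj₂ ≡.refl = proj₂ (bounds x x∈R) ≡.refl
    k<x : ι k < ⟨ coord x , α i j ⟩
    k<x with complement R {x} x∈R i j i≤j k k≤m
    ... | inj₁ x<k = ⊥-elim (lower x<k)
    ... | inj₂ k<x = k<x
    x< : k ℕ.< m → ⟨ coord x , α i j ⟩ < ι (suc k)
    x< k<m with complement R {x} x∈R i j i≤j (suc k) k<m
    ... | inj₁ x<k+1 = x<k+1
    ... | inj₂ k+1<x = ⊥-elim (proj₂ (proj₁ (bounds x x∈R) k<m) k+1<x)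

  region⊆cell : ∀ R → points R ⊆ Cell (shiTableau R)
  region⊆cell R {x} x∈R .entry i j i≤j = case (i Fin.≤? j)
    where
    case : (d : Dec (i Fin.≤ j)) →
      Entry (coord x (inject₁ i) - coord x (suc j)) (shiOrZero R i j d)
    case (yes i≤j) = shiEntry⇒entry R i≤j (proj₂ (shi-exists R i j i≤j)) x x∈R
    case (no i≰j)  = ⊥-elim (i≰j i≤j)
  region⊆cell R _ .empty i j j<i = case (i Fin.≤? j)
    where
    case : (d : Dec (i Fin.≤ j)) → shiOrZero R i j d ≡ 0
    case (yes i≤j) = ⊥-elim (ℕ.<⇒≱ j<i i≤j)
    case (no _)    = ≡.refl

  -- The cell is connected and inside the complement, so maximality of `R` applies. With
  -- `region⊆cell`, every dominant region is the cell of its Shi tableau.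
  cell⊆region : ∀ R {T} → points R ⊆ Cell T → Cell T ⊆ points R
  cell⊆region R {T} = maximal R (Cell T)
    (segmentClosed⇒connected (cell-segmentClosed T)) (λ {x} → cell⊆complement T {x})

  φ-partition : DominantRegion → Partition
  φ-partition R = record
    { part       = φ R
    ; decreasing = λ i≤j → sum-mono-≤ (rows-decreasing tableau i≤j)
    ; bounded    = row-bounded tableau
    }
    where
    tableau : proj₁ (inhabited R) ∈ Cell (shiTableau R)
    tableau = region⊆cell R {proj₁ (inhabited R)} (proj₂ (inhabited R))

  φ≡row-sums : ∀ R {T} v → v ∈ points R → v ∈ Cell T → ∀ i → φ R i ≡ sumℕ (T i)
  φ≡row-sums R v v∈R v∈T i = sum-cong-≗ (tableau-unique (region⊆cell R {v} v∈R) v∈T i)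

  φ-cong : ∀ {R R′} → R ≈ᴿ R′ → φ-partition R ≈ᴾ φ-partition R′
  φ-cong {R} {R′} (R⊆R′ , _) = let x , x∈R = inhabited R in
    φ≡row-sums R x x∈R (region⊆cell R′ {x} (R⊆R′ {x} x∈R))

  φ-injective : ∀ {R R′} → φ-partition R ≈ᴾ φ-partition R′ → R ≈ᴿ R′
  φ-injective {R} {R′} φR≡φR′ = ⊆-of R R′ φR≡φR′ , ⊆-of R′ R (≡.sym ∘ φR≡φR′)
    where
    -- Equal row sums force equal Shi tableaux, so a point of `R` lies in the cell of `R′`, which is
    -- contained in `R′`.
    ⊆-of : ∀ R R′ → (∀ i → φ R i ≡ φ R′ i) → points R ⊆ points R′
    ⊆-of R R′ φR≡φR′ {x} x∈R = cell⊆region R′ (region⊆cell R′) {x} λ where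
        .entry i j i≤j → ≡.subst (Entry _) (same i j) (t .entry i j i≤j)
        .empty i j j<i → t′ .empty i j j<i
      where
      t : x ∈ Cell (shiTableau R)
      t = region⊆cell R {x} x∈R
      t′ : proj₁ (inhabited R′) ∈ Cell (shiTableau R′)
      t′ = region⊆cell R′ {proj₁ (inhabited R′)} (proj₂ (inhabited R′))
      same : ∀ i j → shiTableau R i j ≡ shiTableau R′ i j
      same = row-sums-injective t t′ φR≡φR′

  sum-shift : ∀ {N} (x : Fin N → Carrier) c → sum (λ l → x l - c) ≈ sum x - ι N * c
  sum-shift {zero}  x c = solve 1 (λ c → con (+ 0) := con (+ 0) :- con (+ 0) :* c) refl c
  sum-shift {suc N} x c = trans (+-congˡ (sum-shift (x ∘ suc) c))
    (solve 4 (λ x₀ x i c → x₀ :- c :+ (x :- i :* c) := x₀ :+ x :- (con (+ 1) :+ i) :* c) refl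
      (x zero) (sum (x ∘ suc)) (ι N) c)

  opaque
    -- Entries depend only on differences, so subtracting the mean from every coordinate moves the
    -- points into `V`.
    translate : ∀ {T} {x : Fin (suc n) → Carrier} → IsTableau x T → ∃[ v ] v ∈ Cell T
    translate {T} {x} t with 0<⇒inverse (≤-<-trans (ι-mono-≤ {0} {n} z≤n) (x<1+x (ι n)))
    ... | e , _ , Ne≈1 = centred , λ where
        .entry i j i≤j → entry-resp-≈
          (solve 3 (λ a b c → a :- b := (a :- c) :- (b :- c)) refl (x (inject₁ i)) (x (suc j)) mean)
          (t .entry i j i≤j)
        .empty → t .empty
      where
      mean : Carrier
      mean = e * sum x
      centred : V
      centred .coord l = x l - mean
      centred .sum≈0 = trans (sum-shift x mean) (trans
        (+-congˡ (-‿cong (trans (sym (*-assoc (ι (suc n)) e (sum x)))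
          (trans (*-congʳ Ne≈1) (*-identityˡ (sum x))))))
        (-‿inverseʳ (sum x)))

  φ-surjective : ∀ p → ∃[ R ] (∀ {R′} → R′ ≈ᴿ R → φ-partition R′ ≈ᴾ p)
  φ-surjective p with row-sums-surjective (part p) (decreasing p) (bounded p)
  ... | x , T , t , ΣT≡p with translate t
  -- The single point `v` lies in every region equal to the cell and determines its tableau.
  ...   | v , v∈T = cellRegion v v∈T , λ {R′} (_ , T⊆R′) i →
    ≡.trans (φ≡row-sums R′ v (T⊆R′ {v} v∈T) v∈T i) (ΣT≡p i)

theorem4p1 : (ℝ : RealNumbers) (n m : ℕ) .{{_ : NonZero n}} .{{_ : NonZero m}} →
    let open Catalan ℝ n m in
    Σ[ f ∈ (DominantRegion → Partition) ] (∀ R i → part (f R) i ≡ φ R i) × IsBijection _≈ᴿ_ _≈ᴾ_ f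
theorem4p1 ℝ n m = φ-partition , (λ _ _ → ≡.refl) , record
    { isInjection = record
      { isCongruent = record
        { cong           = φ-cong
        ; isEquivalence₁ = record
          { refl  = id , id
          ; sym   = swap
          ; trans = λ (R⊆S , S⊆R) (S⊆U , U⊆S) → S⊆U ∘ R⊆S , S⊆R ∘ U⊆S
          }
        ; isEquivalence₂ = record
          { refl  = λ _ → ≡.refl
          ; sym   = λ p≡q i → ≡.sym (p≡q i)
          ; trans = λ p≡q q≡r i → ≡.trans (p≡q i) (q≡r i)
          }
        }
      ; injective = φ-injective
      }
    ; surjective = φ-surjective
    }
  where open Regions ℝ n m
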